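{- Let $H=(V,E,w)$ be a weighted hypergraph, $n=|V|$, and $\Phi=\sum_{e\in E}|e|^2$. The time complexities of Gallo's algorithm and of the algorithm DR-SP (both described in the context) for the static single-source shortest hyperpath problem are as follows. (i) For general hypergraphs, Gallo's algorithm takes time $O(n\log n+\Phi)$ and DR-SP takes time $O(n\log n+\Phi)$. (ii) If $H$ is a simplicial complex with $m$ facets and maximum facet dimension $d$, Gallo's algorithm takes time $O(n\log n+d^2 2^d m)$ and DR-SP takes time $O(n\log n+d\,2^d m)$.
   Context: A weighted undirected hypergraph $H=(V,E,w)$ consists of a finite set $V$, a family $E$ of nonempty subsets of $V$ (hyperedges) with $\bigcup_{e\in E}e=V$, and a weight function $w:E\to\mathbb{R}^+\cup\{0\}$. A hyperpath between $u$ and $v$ is a sequence of hyperedges $\{e_0,\dots,e_k\}$ with $u\in e_0$, $v\in e_k$, $e_i\cap e_{i+1}\ne\emptyset$; its weight is $\sum_i w(e_i)$. The static single-source shortest hyperpath problem: given a source $s\in V$, find minimum-weight hyperpaths from $s$ to all other vertices. A simplicial complex is a hypergraph whose hyperedge set is closed under taking (nonempty) subsets; its facets are its inclusion-maximal hyperedges; a hyperedge with $i+1$ vertices has dimension $i$. Gallo's algorithm (Dijkstra extended to hypergraphs): keep tentative distances $D$, with $D[s]=0$ and $D[v]=+\infty$ otherwise, and keep the non-fixed vertices in a Fibonacci heap keyed by $D$. Repeatedly extract (fix) the non-fixed vertex $z$ with minimal $D[z]$ and scan all hyperedges $e$ containing $z$; for every $v\in e$ with $D[v]>D[z]+w(e)$,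 set $D[v]\leftarrow D[z]+w(e)$. DR-SP: Step 1 builds the underlying graph $G=(V,\tilde E)$, in which a vertex pair $\tilde e$ is an edge iff some $e\in E$ contains it, with weight $w_G(\tilde e)=\min_{e\in E,\,e\supseteq\tilde e}w(e)$. For a general hypergraph this is done by scanning, for each hyperedge, all its vertex pairs. For a simplicial complex it is done top-down in the dimension: for a facet $s'$, $w_G(s')=w(s')$; for another face $s$ of dimension $i$, $w_G(s)=\min\{w(s),\{w_G(s'):s'\supset s,\ \dim s'=i+1\}\}$. Step 2 applies Dijkstra's algorithm (with a Fibonacci heap) to the weighted graph $G$ from the source; replacing each edge of a shortest path in $G$ by a hyperedge that lent it its weight gives a shortest hyperpath of the same weight. -}

module Defs where

open import Algebra.Bundles using (CommutativeMonoid)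
open import Data.Bool.Base using (Bool; true; false; if_then_else_)
open import Data.Fin.Base using (Fin)
open import Data.Fin.Properties using (_≟_; any?)
open import Data.Fin.Subset using (Subset; _∈_; _⊆_; _⊂_; Nonempty; ∣_∣)
open import Data.Fin.Subset.Properties using (_∈?_; _⊂?_)
open import Data.List.Base
  using (List; []; _∷_; _++_; _ʳ++_; allFin; downFrom; filter; length; map)
open import Data.List.Extrema.Nat using (max)
open import Data.Maybe.Base using (Maybe; just; nothing; _<∣>_)
open import Data.Nat.Base using (ℕ; zero; suc; _+_; _*_; _∸_; _^_; _≤_)
open import Data.Nat.ListAction using (sum)
import Data.Nat.Properties as ℕ
open import Data.Product.Base using (_×_; _,_; ∃; ∃-syntax)
open import Data.Unit.Base using (⊤; tt)
open import Data.Vec.Base using (Vec; lookup; replicate; tabulate; _[_]≔_)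
open import Function.Definitions using (Injective)
open import Level using (Level; _⊔_) renaming (suc to lsuc)
open import Relation.Binary.Construct.Add.Supremum.NonStrict using (_≤⁺_; ≤⁺-dec)
open import Relation.Binary.Core using (Rel)
open import Relation.Binary.Definitions using (Decidable)
open import Relation.Binary.PropositionalEquality.Core using (_≡_)
open import Relation.Binary.Structures using (IsDecTotalOrder)
open import Relation.Nullary.Construct.Add.Supremum using (_⁺; [_]; ⊤⁺)
open import Relation.Nullary.Decidable.Core using (Dec; does; _×-dec_; ¬?)
open import Relation.Nullary.Negation.Core using (¬_)

private
  variable
    a b c ℓ ℓ₁ ℓ₂ : Level
    A : Set a
    B : Set b
    n : ℕ

-- Unit-cost random-access machine.  One unit is charged for each
-- constant-size group of elementary steps: an array access, a comparison
-- or addition of weights, an iteration or exit test of a loop, a constant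
-- number of pointer updates.

record Timed (A : Set a) : Set a where
  constructor _after_
  field
    result : A
    time   : ℕ

open Timed public

return : A → Timed A
return x = x after 0

infixl 1 _>>=_ _>>_

_>>=_ : Timed A → (A → Timed B) → Timed B
(x after t) >>= f = result (f x) after (t + time (f x))

_>>_ : Timed A → Timed B → Timed B
m >> k = m >>= λ _ → k

charge : ℕ → Timed ⊤
charge t = tt after t

tick : Timed ⊤
tick = charge 1

forEach : List A → (A → B → Timed B) → B → Timed B
forEach []       f s = do
  tick
  return s
forEach (x ∷ xs) f s = do
  tick
  s′ ← f x s
  forEach xs f s′

Array : Set a → ℕ → Set a
Array = Vec

-- Allocation is free, as array cells can be lazily initialised in such a
-- way that allocation and each access take constant time.
newArray : A → Timed (Array A n)
newArray {n = n} x = return (replicate n x)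

read : Array A n → Fin n → Timed A
read xs i = do
  tick
  return (lookup xs i)

write : Fin n → A → Array A n → Timed (Array A n)
write i x xs = do
  tick
  return (xs [ i ]≔ x)

-- A heap holds items from Fin n.  The doubly linked circular lists of
-- siblings are represented by lists; concatenating two of them, or
-- removing a given element, is a constant number of pointer updates.

module FibonacciHeap {κ ℓ : Level} {Key : Set κ} {_≼_ : Rel Key ℓ}
                     (_≼?_ : Decidable _≼_) (n : ℕ) where

  data Tree : Set κ where
    node : (k : Key) (x : Fin n) (marked : Bool) (children : List Tree) → Tree

  key : Tree → Key
  key (node k _ _ _) = k

  -- Stored in the node in the pointer implementation.
  rank : Tree → ℕ
  rank (node _ _ _ cs) = length cs

  -- The list of roots, beginning with the one the minimum pointer refers to.
  Heap : Set κ
  Heap = List Tree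

  empty : Heap
  empty = []

  leq : Key → Key → Timed Bool
  leq k l = do
    tick
    return (does (k ≼? l))

  addRoot : Tree → Heap → Timed Heap
  addRoot t []       = do
    tick
    return (t ∷ [])
  addRoot t (m ∷ ts) = do
    m≼t ← leq (key m) (key t)
    return (if m≼t then m ∷ t ∷ ts else t ∷ m ∷ ts)

  insert : Fin n → Key → Heap → Timed Heap
  insert x k = addRoot (node k x false [])

  adopt : Tree → Tree → Tree
  adopt (node k x b cs) (node l y _ ds) = node k x b (node l y false ds ∷ cs)

  link : Tree → Tree → Timed Tree
  link s t = do
    s≼t ← leq (key s) (key t)
    return (if s≼t then adopt s t else adopt t s)

  -- The array used by consolidation: the slot at position r is for a root
  -- of rank r.  It reaches only up to the largest rank met so far.
  Table : Set κ
  Table = List (Maybe Tree)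

  carry : Tree → Table → Timed Table
  carry t []             = do
    tick
    return (just t ∷ [])
  carry t (nothing ∷ ss) = do
    tick
    return (just t ∷ ss)
  carry t (just s ∷ ss)  = do
    u   ← link s t
    ss′ ← carry u ss
    return (nothing ∷ ss′)

  -- Random access to the slot, so the walk to position r is not charged;
  -- added empty slots are charged when the table is read out.
  placeAt : ℕ → Tree → Table → Timed Table
  placeAt zero    t ss       = carry t ss
  placeAt (suc r) t []       = do
    ss′ ← placeAt r t []
    return (nothing ∷ ss′)
  placeAt (suc r) t (s ∷ ss) = do
    ss′ ← placeAt r t ss
    return (s ∷ ss′)

  collect : Maybe Tree → Heap → Timed Heap
  collect nothing  h = return h
  collect (just t) h = addRoot t h

  consolidate : List Tree → Timed Heap
  consolidate ts = do
    table ← forEach ts (λ t → placeAt (rank t) t) []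
    forEach table collect empty

  extractMin : Heap → Timed (Maybe (Fin n × Heap))
  extractMin []                   = do
    tick
    return nothing
  extractMin (node _ x _ cs ∷ ts) = do
    roots ← forEach cs (λ t ts′ → return (t ∷ ts′)) ts
    h     ← consolidate roots
    return (just (x , h))

  -- A node together with its chain of parent pointers, nearest ancestor
  -- first.  A frame is an ancestor with a hole among its children; the
  -- children left of the hole are in reverse order.
  record Frame : Set κ where
    constructor frame
    field
      k      : Key
      x      : Fin n
      marked : Bool
      left   : List Tree
      right  : List Tree

  plug : Tree → List Frame → Tree
  plug t []                       = t
  plug t (frame k x b ls rs ∷ fs) = plug (node k x b (ls ʳ++ t ∷ rs)) fs

  -- left and right are the roots around the tree that contains the focus.
  record Position : Set κ where
    constructor position
    field
      focus : Tree
      path  : List Frame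
      left  : List Tree
      right : List Tree

  locateInTree     : Fin n → Tree → List Frame → Maybe (Tree × List Frame)
  locateInChildren : Fin n → Key → Fin n → Bool → (left right : List Tree) →
                     List Frame → Maybe (Tree × List Frame)

  locateInTree x t@(node k y b cs) fs =
    if does (x ≟ y) then just (t , fs) else locateInChildren x k y b [] cs fs

  locateInChildren x k y b ls []       fs = nothing
  locateInChildren x k y b ls (t ∷ rs) fs =
    locateInTree x t (frame k y b ls rs ∷ fs) <∣>
    locateInChildren x k y b (t ∷ ls) rs fs

  locate : Fin n → (left right : List Tree) → Maybe Position
  locate x ls []       = nothing
  locate x ls (t ∷ rs) with locateInTree x t []
  ... | just (u , fs) = just (position u fs ls rs)
  ... | nothing       = locate x (t ∷ ls) rs

  -- The given frame has just lost the child in its hole.  The result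
  -- consists of the subtrees cut off and the rest of the whole tree.
  -- Rebuilding the untouched ancestors by plug is not charged, as they
  -- stay in place in the pointer implementation.
  cascadingCut : Frame → List Frame → Timed (List Tree × Tree)
  cascadingCut (frame k x b ls rs)     []       = do
    tick
    return ([] , node k x b (ls ʳ++ rs))
  cascadingCut (frame k x false ls rs) (f ∷ fs) = do
    tick
    return ([] , plug (node k x true (ls ʳ++ rs)) (f ∷ fs))
  cascadingCut (frame k x true ls rs)  (f ∷ fs) = do
    tick
    cuts , rest ← cascadingCut f fs
    return (node k x false (ls ʳ++ rs) ∷ cuts , rest)

  -- Heap order makes the keys of the spliced roots at least the minimum.
  spliceRoots : List Tree → Heap → Heap
  spliceRoots us []       = us
  spliceRoots us (m ∷ ts) = m ∷ us ++ ts

  decreaseAt : Key → Position → Timed Heap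
  decreaseAt k (position (node _ x b cs) [] [] rs) = do
    tick
    return (node k x b cs ∷ rs)
  decreaseAt k (position (node _ x b cs) [] ls@(_ ∷ _) rs) =
    addRoot (node k x b cs) (ls ʳ++ rs)
  decreaseAt k (position (node _ x b cs) (f ∷ fs) ls rs) = do
    inOrder ← leq (Frame.k f) k
    if inOrder
      then return (ls ʳ++ plug (node k x b cs) (f ∷ fs) ∷ rs)
      else do
        cuts , rest ← cascadingCut f fs
        addRoot (node k x false cs) (spliceRoots cuts (ls ʳ++ rest ∷ rs))

  -- The node of an item is reached by a stored pointer, so that locating it
  -- costs one unit.  Nothing happens if the item is not in the heap.
  decreaseKey : Fin n → Key → Heap → Timed Heap
  decreaseKey x k h with locate x [] h
  ... | nothing = do
    tick
    return h
  ... | just p  = do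
    tick
    decreaseAt k p

-- The nonnegative weights are taken from an ordered commutative monoid
-- with decidable total order; the real numbers of a real random-access
-- machine, with addition and comparison as unit-cost operations, are the
-- intended instance.

record Scalars c ℓ₁ ℓ₂ : Set (lsuc (c ⊔ ℓ₁ ⊔ ℓ₂)) where
  field
    +-commutativeMonoid : CommutativeMonoid c ℓ₁

  open CommutativeMonoid +-commutativeMonoid public
    using (Carrier; _≈_)
    renaming (_∙_ to _+ˢ_; ε to 0ˢ)

  field
    _≤ˢ_            : Rel Carrier ℓ₂
    isDecTotalOrder : IsDecTotalOrder _≈_ _≤ˢ_
    +-mono-≤        : ∀ {x y u v} → x ≤ˢ y → u ≤ˢ v → (x +ˢ u) ≤ˢ (y +ˢ v)

  open IsDecTotalOrder isDecTotalOrder public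
    using () renaming (_≤?_ to _≤ˢ?_)

record Hypergraph (K : Scalars c ℓ₁ ℓ₂) : Set (c ⊔ ℓ₂) where
  open Scalars K
  field
    ∣V∣            : ℕ
    ∣E∣            : ℕ
    edge           : Fin ∣E∣ → Subset ∣V∣
    edge-injective : Injective _≡_ _≡_ edge
    edge-nonempty  : ∀ e → Nonempty (edge e)
    covering       : ∀ v → ∃[ e ] v ∈ edge e
    w              : Fin ∣E∣ → Carrier
    w-nonneg       : ∀ e → 0ˢ ≤ˢ w e

  Vertex : Set
  Vertex = Fin ∣V∣

  Edge : Set
  Edge = Fin ∣E∣

  dim : Edge → ℕ
  dim e = ∣ edge e ∣ ∸ 1

  Φ : ℕ
  Φ = sum (map (λ e → ∣ edge e ∣ ^ 2) (allFin ∣E∣))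

  IsSimplicial : Set
  IsSimplicial = ∀ e (p : Subset ∣V∣) → Nonempty p → p ⊆ edge e → ∃[ f ] edge f ≡ p

  IsFacet : Edge → Set
  IsFacet e = ¬ (∃[ f ] edge e ⊂ edge f)

  isFacet? : ∀ e → Dec (IsFacet e)
  isFacet? e = ¬? (any? (λ f → edge e ⊂? edge f))

  facets : List Edge
  facets = filter isFacet? (allFin ∣E∣)

  ∣facets∣ : ℕ
  ∣facets∣ = length facets

  maxFacetDim : ℕ
  maxFacetDim = max 0 (map dim facets)

  -- The input gives, as ready-made lists, the vertices of each hyperedge
  -- and the hyperedges at each vertex; for a simplicial complex it is the
  -- Hasse diagram, so that the faces of each dimension and the faces
  -- covering a given face are listed too.

  verticesOf : Edge → List Vertex
  verticesOf e = filter (_∈? edge e) (allFin ∣V∣)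

  edgesAt : Vertex → List Edge
  edgesAt v = filter (λ e → v ∈? edge e) (allFin ∣E∣)

  facesOfDim : ℕ → List Edge
  facesOfDim i = filter (λ e → dim e ℕ.≟ i) (allFin ∣E∣)

  cofacesOf : Edge → List Edge
  cofacesOf e =
    filter (λ f → (edge e ⊂? edge f) ×-dec (dim f ℕ.≟ suc (dim e))) (allFin ∣E∣)

module Algorithms {K : Scalars c ℓ₁ ℓ₂} (H : Hypergraph K) where
  open Scalars K
  open Hypergraph H

  Distance : Set c
  Distance = Carrier ⁺

  _≤∞?_ : Decidable (_≤⁺_ _≤ˢ_)
  _≤∞?_ = ≤⁺-dec _≤ˢ_ _≤ˢ?_

  open FibonacciHeap _≤∞?_ ∣V∣ public

  _plus_ : Distance → Carrier → Distance
  [ x ] plus y = [ x +ˢ y ]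
  ⊤⁺    plus y = ⊤⁺

  -- The non-fixed vertices are those in the heap.  The entry of pred at v
  -- is the last step of the best hyperpath to v found so far.
  record State : Set c where
    constructor state
    field
      D    : Array Distance ∣V∣
      pred : Array (Maybe (Vertex × Edge)) ∣V∣
      heap : Heap

  initialise : Vertex → Timed State
  initialise s = do
    D    ← newArray ⊤⁺
    pred ← newArray nothing
    forEach (allFin ∣V∣) enter (state D pred empty)
    where
    enter : Vertex → State → Timed State
    enter v (state D pred h) = do
      let d = if does (v ≟ s) then [ 0ˢ ] else ⊤⁺
      D′ ← write v d D
      h′ ← insert v d h
      return (state D′ pred h′)

  relax : Vertex → Vertex → Carrier → Edge → State → Timed State
  relax z v x e (state D pred h) = do
    dz   ← read D z
    dv   ← read D v
    tick
    let d = dz plus x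
    dv≤d ← leq dv d
    if dv≤d
      then return (state D pred h)
      else do
        D′    ← write v d D
        pred′ ← write v (just (z , e)) pred
        h′    ← decreaseKey v d h
        return (state D′ pred′ h′)

  fixVertices : (scan : Vertex → State → Timed State) → ℕ → State → Timed State
  fixVertices scan zero       st                = return st
  fixVertices scan (suc fuel) (state D pred h) = do
    m ← extractMin h
    continue m
    where
    continue : Maybe (Vertex × Heap) → Timed State
    continue nothing         = return (state D pred h)
    continue (just (z , h′)) = do
      st ← scan z (state D pred h′)
      fixVertices scan fuel st

  -- Every round removes one of the initially ∣V∣ items, so that after ∣V∣
  -- rounds the heap is empty.
  labelSetting : (scan : Vertex → State → Timed State) → Vertex → Timed State
  labelSetting scan s = do
    st ← initialise s
    fixVertices scan ∣V∣ st

  gallo : Vertex → Timed State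
  gallo = labelSetting λ z →
    forEach (edgesAt z) λ e →
    forEach (verticesOf e) λ v →
    relax z v (w e) e

  -- A weight together with a hyperedge that lent it.
  Lent : Set c
  Lent = Carrier × Edge

  minLent : Lent → Lent → Timed Lent
  minLent (x , e) (y , f) = do
    tick
    return (if does (x ≤ˢ? y) then (x , e) else (y , f))

  record Graph : Set c where
    constructor graph
    field
      neighbours : Array (List Vertex) ∣V∣
      weight     : Array (Array (Maybe Lent) ∣V∣) ∣V∣

  noEdges : Timed Graph
  noEdges = do
    row        ← newArray nothing
    weight     ← newArray row
    neighbours ← newArray []
    return (graph neighbours weight)

  readWeight : Array (Array (Maybe Lent) ∣V∣) ∣V∣ → Vertex → Vertex →
               Timed (Maybe Lent)
  readWeight W u v = do
    row ← read W u
    read row v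

  writeWeight : Vertex → Vertex → Lent → Array (Array (Maybe Lent) ∣V∣) ∣V∣ →
                Timed (Array (Array (Maybe Lent) ∣V∣) ∣V∣)
  writeWeight u v l W = do
    row  ← read W u
    row′ ← write v (just l) row
    write u row′ W

  addNeighbour : Vertex → Vertex → Array (List Vertex) ∣V∣ →
                 Timed (Array (List Vertex) ∣V∣)
  addNeighbour u v N = do
    vs ← read N u
    write u (v ∷ vs) N

  lend : Lent → Vertex → Vertex → Graph → Timed Graph
  lend l u v (graph N W) = do
    old ← readWeight W u v
    update old
    where
    update : Maybe Lent → Timed Graph
    update nothing   = do
      N₁ ← addNeighbour u v N
      N₂ ← addNeighbour v u N₁
      W₁ ← writeWeight u v l W
      W₂ ← writeWeight v u l W₁
      return (graph N₂ W₂)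
    update (just l₀) = do
      l₁ ← minLent l₀ l
      W₁ ← writeWeight u v l₁ W
      W₂ ← writeWeight v u l₁ W₁
      return (graph N W₂)

  lendToPairs : Lent → List Vertex → Graph → Timed Graph
  lendToPairs l []       G = do
    tick
    return G
  lendToPairs l (u ∷ us) G = do
    tick
    G′ ← forEach us (lend l u) G
    lendToPairs l us G′

  underlyingGraph : Timed Graph
  underlyingGraph = do
    G ← noEdges
    forEach (allFin ∣E∣) (λ e → lendToPairs (w e , e) (verticesOf e)) G

  -- The table of w_G on all faces, starting as a copy of w.  A facet has
  -- no cofaces, so its entry does not change.
  faceWeights : Timed (Array Lent ∣E∣)
  faceWeights = do
    charge ∣E∣
    forEach (downFrom (suc maxFacetDim)) (λ i → forEach (facesOfDim i) visit)
            (tabulate (λ e → w e , e))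
    where
    improve : Edge → Edge → Array Lent ∣E∣ → Timed (Array Lent ∣E∣)
    improve e f T = do
      l  ← read T e
      l′ ← read T f
      m  ← minLent l l′
      write e m T

    visit : Edge → Array Lent ∣E∣ → Timed (Array Lent ∣E∣)
    visit e = forEach (cofacesOf e) (improve e)

  underlyingGraphSimplicial : Timed Graph
  underlyingGraphSimplicial = do
    T ← faceWeights
    G ← noEdges
    forEach (facesOfDim 1) (addFace T) G
    where
    addFace : Array Lent ∣E∣ → Edge → Graph → Timed Graph
    addFace T e G = do
      l ← read T e
      lendToPairs l (verticesOf e) G

  dijkstra : Graph → Vertex → Timed State
  dijkstra (graph N W) = labelSetting scan
    where
    relaxBy : Vertex → Vertex → Maybe Lent → State → Timed State
    relaxBy z v nothing        st = return st
    relaxBy z v (just (x , e)) st = relax z v x e st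

    scan : Vertex → State → Timed State
    scan z st = do
      vs ← read N z
      forEach vs (λ v st′ → readWeight W z v >>= λ l → relaxBy z v l st′) st

  DR-SP : Vertex → Timed State
  DR-SP s = do
    G ← underlyingGraph
    dijkstra G s

  DR-SP-simplicial : Vertex → Timed State
  DR-SP-simplicial s = do
    G ← underlyingGraphSimplicial
    dijkstra G s

record Instance c ℓ₁ ℓ₂ : Set (lsuc (c ⊔ ℓ₁ ⊔ ℓ₂)) where
  field
    {scalars}  : Scalars c ℓ₁ ℓ₂
    hypergraph : Hypergraph scalars
    source     : Hypergraph.Vertex hypergraph

  open Hypergraph hypergraph public
  open Algorithms hypergraph public

SimplicialInstance : ∀ c ℓ₁ ℓ₂ → Set (lsuc (c ⊔ ℓ₁ ⊔ ℓ₂))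
SimplicialInstance c ℓ₁ ℓ₂ = ∃ λ (I : Instance c ℓ₁ ℓ₂) → Instance.IsSimplicial I

-- f = O(g) over a class of instances, where size is the number n of
-- vertices.  Instances with n = 1 are left out, as n log n = 0 for them.
BigO : {A : Set a} (size f g : A → ℕ) → Set a
BigO size f g = ∃[ C ] ∀ I → 2 ≤ size I → f I ≤ C * g I

{-# OPTIONS --safe #-}
module Submission where

-- The potential of a Fibonacci heap, a combination of the numbers of its roots
-- and marks, is enlarged by a weight W x for every item x it holds, where W x
-- bounds the cost of scanning x.  Since extracting x releases W x, a label
-- setting run on n vertices takes time O(n log n + Σ W).  The bounds come
-- from the structure of the trees alone; neither heap order nor the
-- correctness of the distances plays a role.  Exchanging the sums over
-- vertices and hyperedges turns Σ W into O(n + Φ), and the size of the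
-- underlying graph is charged to the time spent on building it.
--
-- Every hyperedge lies in a facet, so there are at most 2^(d+1) m of them,
-- each of at most d+1 vertices; pairs of a face and a coface are counted by the
-- vertex removed.  If d = 0, the bounds d 2^d m vanish, but then all
-- hyperedges are singletons and there are at most n of them.

open import Data.Bool.Base using (Bool; true; false; if_then_else_)
open import Data.Fin.Base using (Fin; zero; suc)
open import Data.Fin.Properties using (_≟_; any?; injective⇒≤)
open import Data.Fin.Subset
  using (Subset; inside; outside; _∈_; _⊆_; _⊂_; _⊃_; _-_; ⁅_⁆; ∣_∣; Nonempty)
open import Data.Fin.Subset.Induction using (⊃-wellFounded; Acc; acc)
open import Data.Fin.Subset.Properties
  using ( _∈?_; _⊂?_; drop-∷-⊆; p⊆q⇒∣p∣≤∣q∣; ∣p∣≤n; ∣⁅x⁆∣≡1; x∈⁅y⁆⇒x≡y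
        ; x∈p∧x≢y⇒x∈p-y; x∈p⇒∣p-x∣<∣p∣ )
open import Data.List.Base as List
  using (List; []; _∷_; _++_; _ʳ++_; map; length; filter; allFin; downFrom; concatMap; catMaybes)
open import Data.List.Extrema.Nat using (xs≤max; max≤v⁺)
open import Data.List.Membership.Propositional using () renaming (_∈_ to _∈ˡ_)
open import Data.List.Membership.Propositional.Properties
  using (∈-filter⁺; ∈-filter⁻; ∈-map⁺; ∈-map⁻; ∈-++⁺ˡ; ∈-++⁺ʳ; ∈-allFin; ∈-lookup; ∈-concatMap⁺)
open import Data.List.Properties
  using ( map-cong; map-tabulate; length-map; length-++; length-ʳ++; length-tabulate
        ; length-downFrom; ++-identityʳ )
open import Data.List.Relation.Binary.Permutation.Propositional as ↭
  using (_↭_; refl; prep; swap; ↭-sym; ↭-trans; ↭-reflexive)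
open import Data.List.Relation.Binary.Permutation.Propositional.Properties
  using (All-resp-↭; ↭-length; ++↭ʳ++; ++⁺ˡ; shift)
open import Data.List.Relation.Unary.All as All using (All; []; _∷_)
open import Data.List.Relation.Unary.All.Properties using (++⁺)
open import Data.List.Relation.Unary.AllPairs using (_∷_)
open import Data.List.Relation.Unary.Any as Any using (here)
open import Data.List.Relation.Unary.Any.Properties using (lookup-index)
open import Data.List.Relation.Unary.Unique.Propositional using (Unique)
import Data.List.Relation.Unary.Unique.Propositional.Properties as Unique
open import Data.Maybe.Base using (Maybe; just; nothing)
import Data.Maybe.Relation.Unary.All as Maybe
open import Data.Nat.Base
open import Data.Nat.ListAction using (sum)
open import Data.Nat.Logarithm using (⌊log₂_⌋; ⌊log₂⌋-mono-≤; ⌊log₂[2^n]⌋≡n)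
open import Data.Nat.Properties renaming (_≟_ to _≟ℕ_)
open import Data.Nat.Tactic.RingSolver using (solve-∀)
open import Data.Product.Base using (_×_; _,_; proj₁; proj₂; ∃; ∃-syntax)
open import Data.Unit.Base using (⊤; tt)
open import Data.Vec.Base using (Vec; []; _∷_; here; lookup; replicate; _[_]≔_)
open import Data.Vec.Properties using (lookup-replicate)
open import Function.Base using (_∘_; id)
open import Function.Definitions using (Injective)
open import Level using (Level)
open import Relation.Binary.Core using (Rel)
import Relation.Binary.Definitions as Binary
open import Relation.Binary.PropositionalEquality
  using (_≡_; refl; sym; trans; cong; cong₂; subst; module ≡-Reasoning)
open import Relation.Nullary.Construct.Add.Supremum using ([_]; ⊤⁺)
open import Relation.Nullary.Decidable.Core using (does; yes; no; _×-dec_)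
open import Relation.Nullary.Negation using (contradiction)
open import Relation.Unary using (Pred; Decidable)
open import Defs

-- Multiplying the number of rounds by the cost of the worst scan would overshoot, and which vertex
-- is fixed in which round depends on the keys. With `W x` inside the potential, the heap itself
-- carries the budget of the vertices still to be scanned: it is deposited on insertion and
-- withdrawn on extraction. Two quantities are followed through every heap operation: the credits,
-- and the number of items, which bounds the ranks. Both are instances of `weighs c W`: `c = 4`
-- gives the credits, and `c = 0` with constant `W` gives the size. The structural lemmas are
-- therefore proved for all `c` and `W` at once. All bounds carry explicit constants and are
-- combined linearly by `by-sum`, so that only semiring identities remain to be checked.

private
  variable
    a b ℓp ℓq : Level
    A : Set a
    B : Set b

-- Reduces a linear inequality to a semiring identity: l ≤ r is the sum of
-- its hypotheses and k the slack.
by-sum : ∀ {x y l r} k → l ≤ r → x + r + k ≡ y + l → x ≤ y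
by-sum {x} {y} {l} {r} k l≤r eq = +-cancelʳ-≤ r x y (begin
  x + r      ≤⟨ m≤m+n (x + r) k ⟩
  x + r + k  ≡⟨ eq ⟩
  y + l      ≤⟨ +-monoʳ-≤ y l≤r ⟩
  y + r      ∎)
  where open ≤-Reasoning

-- Finite sums over lists.

∑ : List A → (A → ℕ) → ℕ
∑ xs f = sum (map f xs)

infix 5 ∑
syntax ∑ xs (λ x → e) = ∑[ x ← xs ] e

∑-mono : ∀ {f g : A → ℕ} → (∀ x → f x ≤ g x) → ∀ xs → ∑ xs f ≤ ∑ xs g
∑-mono f≤g []       = z≤n
∑-mono f≤g (x ∷ xs) = +-mono-≤ (f≤g x) (∑-mono f≤g xs)

∑-cong : ∀ {f g : A → ℕ} → (∀ x → f x ≡ g x) → ∀ xs → ∑ xs f ≡ ∑ xs g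
∑-cong f≡g xs = cong sum (map-cong f≡g xs)

∑-+ : ∀ (f g : A → ℕ) xs → ∑ xs (λ x → f x + g x) ≡ ∑ xs f + ∑ xs g
∑-+ f g []       = refl
∑-+ f g (x ∷ xs) rewrite ∑-+ f g xs = interchange (f x) (g x) (∑ xs f) (∑ xs g)
  where
  interchange : ∀ a b c d → (a + b) + (c + d) ≡ (a + c) + (b + d)
  interchange = solve-∀

∑-const : ∀ c (xs : List A) → ∑ xs (λ _ → c) ≡ length xs * c
∑-const c []       = refl
∑-const c (x ∷ xs) = cong (c +_) (∑-const c xs)

∑-* : ∀ c (f : A → ℕ) xs → ∑ xs (λ x → c * f x) ≡ c * ∑ xs f
∑-* c f []       = sym (*-zeroʳ c)
∑-* c f (x ∷ xs) rewrite ∑-* c f xs = sym (*-distribˡ-+ c (f x) (∑ xs f))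

∑-swap : ∀ (f : A → B → ℕ) xs ys →
         ∑ xs (λ x → ∑ ys (f x)) ≡ ∑ ys (λ y → ∑ xs (λ x → f x y))
∑-swap f []       ys = sym (trans (∑-const 0 ys) (*-zeroʳ (length ys)))
∑-swap f (x ∷ xs) ys rewrite ∑-swap f xs ys =
  sym (∑-+ (f x) (λ y → ∑ xs (λ x → f x y)) ys)

∑-filter : ∀ {P : Pred A ℓp} (P? : Decidable P) f xs →
           ∑ (filter P? xs) f ≡ ∑ xs (λ x → if does (P? x) then f x else 0)
∑-filter P? f []       = refl
∑-filter P? f (x ∷ xs) with does (P? x)
... | true  = cong (f x +_) (∑-filter P? f xs)
... | false = ∑-filter P? f xs

-- A Hoare triple with credits: started with c credits, the computation m
-- pays for its time, keeps pot and establishes P.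
record Within {A : Set a} (m : Timed A) (P : A → Set ℓp) (pot : A → ℕ) (c : ℕ) : Set ℓp where
  constructor within
  field
    post  : P (result m)
    bound : time m + pot (result m) ≤ c

open Within public

weaken : ∀ {m : Timed A} {P : A → Set ℓp} {pot c d} →
         Within m P pot c → c ≤ d → Within m P pot d
weaken (within P b) c≤d = within P (≤-trans b c≤d)

bind-within : ∀ {m : Timed A} {f : A → Timed B} {P : A → Set ℓp} {Q : B → Set ℓq}
                {pot : A → ℕ} {pot′ : B → ℕ} {c d} →
              Within m P pot c →
              (∀ {x} → P x → Within (f x) Q pot′ (d + pot x)) →
              Within (m >>= f) Q pot′ (d + c)
bind-within {m = m} {f = f} {pot = pot} {pot′} {c} {d} (within p b) step with step p
... | within q b′ = within q
  (by-sum 0 (+-mono-≤ b b′)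
            (eq (time m) (pot (result m)) (time (f (result m))) (pot′ (result (f (result m)))) c d))
  where
  eq : ∀ t u t′ u′ c d → t + t′ + u′ + (c + (d + u)) + 0 ≡ d + c + (t + u + (t′ + u′))
  eq = solve-∀

spend : ∀ k {m : Timed A} {P : A → Set ℓp} {pot c} →
        Within m P pot c → Within (charge k >> m) P pot (k + c)
spend k {m} {pot = pot} (within p b) =
  within p (≤-trans (≤-reflexive (+-assoc k (time m) (pot (result m)))) (+-monoʳ-≤ k b))

-- Indexing `P` by the remaining list lets an invariant speak of the iterations still to come, as
-- `Inserting` does below. Each iteration and the exit test contribute one unit.
forEach-within : ∀ {f : A → B → Timed B} (P : List A → B → Set ℓp) (pot : B → ℕ) (cost : A → ℕ) →
                 (∀ {x xs s} → P (x ∷ xs) s → Within (f x s) (P xs) pot (cost x + pot s)) →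
                 ∀ xs s → P xs s →
                 Within (forEach xs f s) (P []) pot (1 + ∑ xs (λ x → 1 + cost x) + pot s)
forEach-within P pot cost step []       s p = within p ≤-refl
forEach-within {f = f} P pot cost step (x ∷ xs) s p with step p
... | within p′ b with forEach-within P pot cost step xs (result (f x s)) p′
... | within p″ b′ = within p″
  (by-sum 0 (+-mono-≤ b b′)
    (eq (cost x) (pot s) (time (f x s)) (pot (result (f x s))) (∑ xs (λ x → 1 + cost x)) _ _))
  where
  eq : ∀ c p t q S u r → 1 + (t + u) + r + ((c + p) + (1 + S + q)) + 0
                       ≡ 1 + (1 + c + S) + p + (t + q + (u + r))
  eq = solve-∀

-- Fibonacci heaps

-- The Fibonacci number F_{k+2}, with F₁ = F₂ = 1.
fib⁺⁺ : ℕ → ℕ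
fib⁺⁺ 0             = 1
fib⁺⁺ 1             = 2
fib⁺⁺ (suc (suc k)) = fib⁺⁺ (suc k) + fib⁺⁺ k

fib⁺⁺-≤-suc : ∀ k → fib⁺⁺ k ≤ fib⁺⁺ (suc k)
fib⁺⁺-≤-suc zero    = s≤s z≤n
fib⁺⁺-≤-suc (suc k) = m≤m+n _ _

fib⁺⁺-mono : ∀ {j k} → j ≤ k → fib⁺⁺ j ≤ fib⁺⁺ k
fib⁺⁺-mono {j} j≤k = go (≤⇒≤′ j≤k)
  where
  go : ∀ {k} → j ≤′ k → fib⁺⁺ j ≤ fib⁺⁺ k
  go ≤′-refl       = ≤-refl
  go (≤′-step {k} j≤k) = ≤-trans (go j≤k) (fib⁺⁺-≤-suc k)

-- Doubling every two steps is enough for a logarithmic rank bound and avoids the golden ratio.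
2^⌊k/2⌋≤fib⁺⁺ : ∀ k → 2 ^ ⌊ k /2⌋ ≤ fib⁺⁺ k
2^⌊k/2⌋≤fib⁺⁺ 0             = ≤-refl
2^⌊k/2⌋≤fib⁺⁺ 1             = s≤s z≤n
2^⌊k/2⌋≤fib⁺⁺ (suc (suc k)) =
  +-mono-≤ (≤-trans ih (fib⁺⁺-≤-suc k)) (≤-trans (≤-reflexive (+-identityʳ _)) ih)
  where ih = 2^⌊k/2⌋≤fib⁺⁺ k

-- A strict bound on ranks, so that it also bounds the number of table slots, whose positions start
-- at 0.
rankBound : ℕ → ℕ
rankBound N = 2 + 2 * ⌊log₂ N ⌋

fib⁺⁺≤⇒<rankBound : ∀ {k N} → fib⁺⁺ k ≤ N → suc k ≤ rankBound N
fib⁺⁺≤⇒<rankBound {k} {N} fib≤N = s≤s (begin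
  k                    ≤⟨ halves k ⟩
  1 + 2 * ⌊ k /2⌋      ≤⟨ s≤s (*-monoʳ-≤ 2 half≤log) ⟩
  1 + 2 * ⌊log₂ N ⌋    ∎)
  where
  open ≤-Reasoning
  halves : ∀ k → k ≤ 1 + 2 * ⌊ k /2⌋
  halves 0             = z≤n
  halves 1             = s≤s z≤n
  halves (suc (suc k)) = by-sum 0 (halves k) (eq k ⌊ k /2⌋)
    where
    eq : ∀ k h → suc (suc k) + (1 + 2 * h) + 0 ≡ 1 + 2 * suc h + k
    eq = solve-∀
  half≤log : ⌊ k /2⌋ ≤ ⌊log₂ N ⌋
  half≤log = begin
    ⌊ k /2⌋                 ≡⟨ ⌊log₂[2^n]⌋≡n ⌊ k /2⌋ ⟨
    ⌊log₂ 2 ^ ⌊ k /2⌋ ⌋     ≤⟨ ⌊log₂⌋-mono-≤ (≤-trans (2^⌊k/2⌋≤fib⁺⁺ k) fib≤N) ⟩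
    ⌊log₂ N ⌋               ∎

module HeapAnalysis {κ ℓ : Level} {Key : Set κ} {_≼_ : Rel Key ℓ}
                    (_≼?_ : Binary.Decidable _≼_) (n : ℕ) where

  open FibonacciHeap _≼?_ n

  bit : Bool → ℕ
  bit true  = 1
  bit false = 0

  -- For a child, its rank at the time it was linked.
  slack : Tree → ℕ
  slack (node _ _ b cs) = bit b + length cs

  -- The i-th child, counted from the oldest, has been linked at rank at
  -- least i and has since lost at most the one child its mark records.
  mutual
    Wf : Tree → Set
    Wf (node _ _ _ cs) = WfSiblings cs

    WfSiblings : List Tree → Set
    WfSiblings []       = ⊤
    WfSiblings (t ∷ ts) = Wf t × length ts ≤ slack t × WfSiblings ts

  -- With weight c for a mark and W x for an item x.
  mutual
    weigh : ℕ → (Fin n → ℕ) → Tree → ℕ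
    weigh c W (node _ x b cs) = W x + c * bit b + weighs c W cs

    weighs : ℕ → (Fin n → ℕ) → List Tree → ℕ
    weighs c W []       = 0
    weighs c W (t ∷ ts) = weigh c W t + weighs c W ts

  module _ (c : ℕ) (W : Fin n → ℕ) where

    weighs-↭ : ∀ {ts us} → ts ↭ us → weighs c W ts ≡ weighs c W us
    weighs-↭ refl             = refl
    weighs-↭ (prep t p)       = cong (weigh c W t +_) (weighs-↭ p)
    weighs-↭ (swap {xs} t u p) rewrite weighs-↭ p =
      eq (weigh c W t) (weigh c W u) _
      where
      eq : ∀ t u x → t + (u + x) ≡ u + (t + x)
      eq = solve-∀
    weighs-↭ (↭.trans p q)    = trans (weighs-↭ p) (weighs-↭ q)

    weighs-++ : ∀ ts us → weighs c W (ts ++ us) ≡ weighs c W ts + weighs c W us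
    weighs-++ []       us = refl
    weighs-++ (t ∷ ts) us rewrite weighs-++ ts us =
      sym (+-assoc (weigh c W t) _ _)

    weighs-ʳ++ : ∀ ts us → weighs c W (ts ʳ++ us) ≡ weighs c W ts + weighs c W us
    weighs-ʳ++ ts us = trans (sym (weighs-↭ (++↭ʳ++ ts us))) (weighs-++ ts us)

    weighPath : List Frame → ℕ
    weighPath []                       = 0
    weighPath (frame _ x b ls rs ∷ fs) =
      W x + c * bit b + (weighs c W ls + weighs c W rs) + weighPath fs

    weigh-plug : ∀ t fs → weigh c W (plug t fs) ≡ weigh c W t + weighPath fs
    weigh-plug t []                       = sym (+-identityʳ _)
    weigh-plug t (frame k x b ls rs ∷ fs)
      rewrite weigh-plug (node k x b (ls ʳ++ t ∷ rs)) fs | weighs-ʳ++ ls (t ∷ rs) =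
      eq (W x + c * bit b) (weighs c W ls) (weigh c W t) (weighs c W rs) (weighPath fs)
      where
      eq : ∀ x l t r p → x + (l + (t + r)) + p ≡ t + (x + (l + r) + p)
      eq = solve-∀

  size : Tree → ℕ
  size = weigh 0 (λ _ → 1)

  sizes : List Tree → ℕ
  sizes = weighs 0 (λ _ → 1)

  mutual
    fib⁺⁺-rank≤size : ∀ t → Wf t → fib⁺⁺ (rank t) ≤ size t
    fib⁺⁺-rank≤size (node _ _ _ cs) wf = fib⁺⁺-length≤sizes cs wf

    -- The youngest child has slack at least the number of its older siblings, hence rank at least
    -- one less, so its size supplies the second term of the Fibonacci recurrence. For an only child
    -- `pred` truncates, and 2 = 1 + 1 still holds.
    fib⁺⁺-length≤sizes : ∀ ts → WfSiblings ts → fib⁺⁺ (length ts) ≤ suc (sizes ts)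
    fib⁺⁺-length≤sizes []       _                  = ≤-refl
    fib⁺⁺-length≤sizes (t ∷ ts) (wf , l≤s , wfs) = begin
      fib⁺⁺ (suc (length ts))                        ≤⟨ step (length ts) ⟩
      fib⁺⁺ (length ts) + fib⁺⁺ (pred (length ts))   ≤⟨ +-mono-≤ (fib⁺⁺-length≤sizes ts wfs) size≥ ⟩
      suc (sizes ts) + size t                        ≡⟨ cong suc (+-comm (sizes ts) (size t)) ⟩
      suc (size t + sizes ts)                        ∎
      where
      open ≤-Reasoning
      step : ∀ k → fib⁺⁺ (suc k) ≤ fib⁺⁺ k + fib⁺⁺ (pred k)
      step zero    = ≤-refl
      step (suc k) = ≤-refl
      slack≤1+rank : ∀ u → slack u ≤ suc (rank u)
      slack≤1+rank (node _ _ true  _) = ≤-refl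
      slack≤1+rank (node _ _ false _) = n≤1+n _
      size≥ : fib⁺⁺ (pred (length ts)) ≤ size t
      size≥ = ≤-trans (fib⁺⁺-mono (pred-mono-≤ (≤-trans l≤s (slack≤1+rank t))))
                      (fib⁺⁺-rank≤size t wf)

  siblings-tail : ∀ ls {ts} → WfSiblings (ls ʳ++ ts) → WfSiblings ts
  siblings-tail []       wf = wf
  siblings-tail (l ∷ ls) wf = proj₂ (proj₂ (siblings-tail ls wf))

  -- The children in `ls` are younger than those in the replaced part. If that part does not grow,
  -- their positions do not increase, so the demands on their slack only get weaker.
  siblings-replace : ∀ ls {ts us} → (WfSiblings ts → WfSiblings us) →
                     length us ≤ length ts → WfSiblings (ls ʳ++ ts) → WfSiblings (ls ʳ++ us)
  siblings-replace []       f us≤ts wf = f wf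
  siblings-replace (l ∷ ls) f us≤ts wf =
    siblings-replace ls (λ (w , b , ws) → w , ≤-trans us≤ts b , f ws) (s≤s us≤ts) wf

  siblings-remove : ∀ ls {t rs} → WfSiblings (ls ʳ++ t ∷ rs) → WfSiblings (ls ʳ++ rs)
  siblings-remove ls = siblings-replace ls (λ (_ , _ , ws) → ws) (n≤1+n _)

  wf-focus : ∀ {t} fs → Wf (plug t fs) → Wf t
  wf-focus []                       wf = wf
  wf-focus (frame k x b ls rs ∷ fs) wf = proj₁ (siblings-tail ls (wf-focus fs wf))

  -- The ancestors see only the slack of the focus. It is kept by a change of key, and also by the
  -- loss of a child that is recorded by a new mark.
  wf-refocus : ∀ {t u} fs → Wf u → slack t ≤ slack u → Wf (plug t fs) → Wf (plug u fs)
  wf-refocus         []                       wf-u t≤u wf = wf-u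
  wf-refocus {t} {u} (frame k x b ls rs ∷ fs) wf-u t≤u wf = wf-refocus fs
    (siblings-replace ls (λ (_ , b , ws) → wf-u , ≤-trans b t≤u , ws) ≤-refl (wf-focus fs wf))
    (+-monoʳ-≤ (bit b) (≤-reflexive (trans (length-ʳ++ ls) (sym (length-ʳ++ ls)))))
    wf

  -- Linking and consolidation.

  addRoot-↭ : ∀ t h → result (addRoot t h) ↭ t ∷ h
  addRoot-↭ t []       = refl
  addRoot-↭ t (m ∷ ts) with does (key m ≼? key t)
  ... | true  = swap m t refl
  ... | false = refl

  time-addRoot : ∀ t h → time (addRoot t h) ≡ 1
  time-addRoot t []       = refl
  time-addRoot t (m ∷ ts) = refl

  record Linked (s t u : Tree) : Set where
    field
      wf      : Wf u
      rank-u  : rank u ≡ suc (rank s)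
      weigh-u : ∀ c W → weigh c W u ≤ weigh c W s + weigh c W t

  -- The adopted tree becomes the youngest child, at position `rank s`; its mark is cleared, so its
  -- slack is `rank t`, and equality of the ranks is just what well-formedness asks.
  adopt-linked : ∀ s t → Wf s → Wf t → rank s ≡ rank t → Linked s t (adopt s t)
  adopt-linked (node k x b cs) (node l y b′ ds) wf-s wf-t r = record
    { wf      = wf-t , ≤-reflexive r , wf-s
    ; rank-u  = refl
    -- The slack is the weight of the mark cleared.
    ; weigh-u = λ c W → by-sum (c * bit b′) (≤-refl {0})
        (eq (W x) (c * bit b) (weighs c W cs) (W y) c (c * bit b′) (weighs c W ds))
    }
    where
    eq : ∀ x b cs y c b′ ds → x + b + (y + c * 0 + ds + cs) + 0 + b′
                            ≡ x + b + cs + (y + b′ + ds) + 0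
    eq = solve-∀

  link-linked : ∀ s t → Wf s → Wf t → rank s ≡ rank t → Linked s t (result (link s t))
  link-linked s t wf-s wf-t r with does (key s ≼? key t)
  ... | true  = adopt-linked s t wf-s wf-t r
  ... | false = record
    { wf      = Linked.wf ts
    ; rank-u  = trans (Linked.rank-u ts) (cong suc (sym r))
    ; weigh-u = λ c W → ≤-trans (Linked.weigh-u ts c W) (≤-reflexive (+-comm (weigh c W t) _))
    }
    where ts = adopt-linked t s wf-t wf-s (sym r)

  -- The last slot is never empty, so that the length of a table is bounded
  -- through the size of the tree in it.
  data Slots : ℕ → Table → Set κ where
    []       : ∀ {r} → Slots r []
    occupied : ∀ {r t ss} → Wf t → rank t ≡ r → Slots (suc r) ss → Slots r (just t ∷ ss)
    vacant   : ∀ {r ss} → 0 < length ss → Slots (suc r) ss → Slots r (nothing ∷ ss)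

  trees : Table → List Tree
  trees = catMaybes

  -- The number of trees in the table is a potential, as for a binary counter: a link costs one unit
  -- and removes one tree. What remains is one unit for the final store and one for the tree added,
  -- hence the 2 in `cost`.
  record Placed (r : ℕ) (t : Tree) (ss : Table) (m : Timed Table) : Set κ where
    field
      slots    : Slots r (result m)
      nonempty : 0 < length (result m)
      cost     : time m + length (trees (result m)) ≤ 2 + length (trees ss)
      weight   : ∀ c W → weighs c W (trees (result m)) ≤ weigh c W t + weighs c W (trees ss)

  open Placed

  placed-here : ∀ {r t} ss₀ {ss} → trees ss₀ ≡ trees ss → Wf t → rank t ≡ r → Slots (suc r) ss →
                Placed r t ss₀ ((just t ∷ ss) after 1)
  placed-here {t = t} ss₀ eq wf-t r sl = record
    { slots    = occupied wf-t r sl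
    ; nonempty = s≤s z≤n
    ; cost     = ≤-reflexive (cong (λ us → 2 + length us) (sym eq))
    ; weight   = λ c W → ≤-reflexive (cong (λ us → weigh c W t + weighs c W us) (sym eq))
    }

  carry-placed : ∀ {r} t ss → Wf t → rank t ≡ r → Slots r ss → Placed r t ss (carry t ss)
  carry-placed t []             wf-t r sl = placed-here [] refl wf-t r []
  carry-placed t (nothing ∷ ss) wf-t r (vacant _ sl) = placed-here (nothing ∷ ss) refl wf-t r sl
  carry-placed t (just s ∷ ss)  wf-t r (occupied wf-s r′ sl) = record
    { slots    = vacant (nonempty ih) (slots ih)
    ; nonempty = s≤s z≤n
    ; cost     = s≤s (≤-trans
        (≤-reflexive (cong (_+ length (trees (result (carry u ss)))) (+-identityʳ (time (carry u ss)))))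
        (cost ih))
    ; weight   = λ c W → ≤-trans (weight ih c W)
        (by-sum 0 (Linked.weigh-u lk c W) (eq (weigh c W u) (weigh c W s) (weigh c W t) _))
    }
    where
    u  = result (link s t)
    lk = link-linked s t wf-s wf-t (trans r′ (sym r))
    ih = carry-placed u ss (Linked.wf lk) (trans (Linked.rank-u lk) (cong suc r′)) sl
    eq : ∀ u s t x → u + x + (s + t) + 0 ≡ t + (s + x) + u
    eq = solve-∀

  placed-after-nothing : ∀ {r t ss m} → Placed (suc r) t ss m →
                         Placed r t (nothing ∷ ss) (m >>= λ ss′ → return (nothing ∷ ss′))
  placed-after-nothing {m = m} p = record
    { slots    = vacant (nonempty p) (slots p)
    ; nonempty = s≤s z≤n
    ; cost     = ≤-trans (≤-reflexive (cong (_+ _) (+-identityʳ (time m)))) (cost p)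
    ; weight   = weight p
    }

  placeAt-placed : ∀ {r} i t ss → Wf t → rank t ≡ i + r → Slots r ss → Placed r t ss (placeAt i t ss)
  placeAt-placed zero    t ss             wf-t eq sl = carry-placed t ss wf-t eq sl
  -- A missing slot holds the same trees as a vacant one, so the fields carry over unchanged. The
  -- slot added is not the last, since the placement fills one behind it.
  placeAt-placed {r} (suc i) t []         wf-t eq sl = record
    { slots    = slots p
    ; nonempty = nonempty p
    ; cost     = cost p
    ; weight   = weight p
    }
    where p = placed-after-nothing
                (placeAt-placed i t [] wf-t (trans eq (sym (+-suc i r))) [])
  placeAt-placed {r} (suc i) t (nothing ∷ ss) wf-t eq (vacant _ sl) =
    placed-after-nothing (placeAt-placed i t ss wf-t (trans eq (sym (+-suc i r))) sl)
  placeAt-placed {r} (suc i) t (just s ∷ ss) wf-t eq (occupied wf-s r′ sl) = record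
    { slots    = occupied wf-s r′ (slots p)
    ; nonempty = s≤s z≤n
    ; cost     = by-sum 0 (cost p) (eq₁ (time m) (length (trees (result m))) (length (trees ss)))
    ; weight   = λ c W → by-sum 0 (weight p c W) (eq₂ (weigh c W s) (weigh c W t) _ _)
    }
    where
    m = placeAt i t ss
    p = placeAt-placed i t ss wf-t (trans eq (sym (+-suc i r))) sl
    eq₁ : ∀ t u s → t + 0 + suc u + (2 + s) + 0 ≡ 2 + suc s + (t + u)
    eq₁ = solve-∀
    eq₂ : ∀ s t x y → s + x + (t + y) + 0 ≡ t + (s + y) + x
    eq₂ = solve-∀

  -- The last slot is occupied, by a tree of rank `r + pred (length ss)`, and that tree alone has
  -- the required size.
  slots-length : ∀ {r} ss → Slots r ss → 0 < length ss → fib⁺⁺ (r + pred (length ss)) ≤ sizes (trees ss)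
  slots-length {r} (just t ∷ []) (occupied wf-t refl []) _
    rewrite +-identityʳ (rank t) | +-identityʳ (size t) = fib⁺⁺-rank≤size t wf-t
  slots-length {r} (just t ∷ ss@(_ ∷ ss′)) (occupied wf-t eq sl) _ rewrite +-suc r (length ss′) =
    ≤-trans (slots-length ss sl (s≤s z≤n)) (m≤n+m (sizes (trees ss)) (size t))
  slots-length {r} (nothing ∷ ss@(_ ∷ ss′)) (vacant _ sl) _ rewrite +-suc r (length ss′) =
    slots-length ss sl (s≤s z≤n)

  slots-wf : ∀ {r ss} → Slots r ss → All Wf (trees ss)
  slots-wf []                   = []
  slots-wf (occupied wf-t _ sl) = wf-t ∷ slots-wf sl
  slots-wf (vacant _ sl)        = slots-wf sl

  slots-length≤rankBound : ∀ {ss N} → Slots 0 ss → sizes (trees ss) ≤ N → length ss ≤ rankBound N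
  slots-length≤rankBound {[]}     sl ≤N = z≤n
  slots-length≤rankBound {s ∷ ss} {N} sl ≤N =
    fib⁺⁺≤⇒<rankBound {k = length ss} (≤-trans (slots-length (s ∷ ss) sl (s≤s z≤n)) ≤N)

  length-trees : ∀ ss → length (trees ss) ≤ length ss
  length-trees []             = z≤n
  length-trees (just _ ∷ ss)  = s≤s (length-trees ss)
  length-trees (nothing ∷ ss) = m≤n⇒m≤1+n (length-trees ss)

  collect-↭ : ∀ ss h → result (forEach ss collect h) ↭ trees ss ++ h
  collect-↭ []             h = refl
  collect-↭ (nothing ∷ ss) h = collect-↭ ss h
  collect-↭ (just t ∷ ss)  h =
    ↭-trans (collect-↭ ss _) (↭-trans (++⁺ˡ (trees ss) (addRoot-↭ t h)) (shift t (trees ss) h))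

  time-collect : ∀ ss h → time (forEach ss collect h) ≡ 1 + length ss + length (trees ss)
  time-collect []             h = refl
  time-collect (nothing ∷ ss) h = cong suc (time-collect ss h)
  time-collect (just t ∷ ss)  h rewrite time-addRoot t h | time-collect ss (result (addRoot t h)) =
    cong suc (sym (cong suc (+-suc (length ss) _)))

  -- The factor 3 is one unit for the iteration and two for the placement.
  placeAll : ∀ ts ss → All Wf ts → Slots 0 ss →
             let m = forEach ts (λ t → placeAt (rank t) t) ss in
             Slots 0 (result m) ×
             time m + length (trees (result m)) ≤ 1 + 3 * length ts + length (trees ss) ×
             (∀ c W → weighs c W (trees (result m)) ≤ weighs c W ts + weighs c W (trees ss))
  placeAll []       ss wfs          sl = sl , ≤-refl , λ c W → ≤-refl
  placeAll (t ∷ ts) ss (wf-t ∷ wfs) sl with placeAll ts (result (placeAt (rank t) t ss)) wfs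
    (slots (placeAt-placed (rank t) t ss wf-t (sym (+-identityʳ _)) sl))
  ... | sl′ , cost′ , weight′ =
    sl′
    , by-sum 0 (+-mono-≤ (cost p) cost′)
        (eq₁ (time m) (length (trees (result m))) (length (trees ss)) (length ts) _ _)
    , λ c W → by-sum 0 (+-mono-≤ (weight p c W) (weight′ c W))
        (eq₂ (weighs c W (trees (result m))) (weigh c W t) (weighs c W (trees ss)) (weighs c W ts) _)
    where
    m = placeAt (rank t) t ss
    p = placeAt-placed (rank t) t ss wf-t (sym (+-identityʳ _)) sl
    eq₁ : ∀ t u s l t′ u′ → suc (t + t′) + u′ + (2 + s + (1 + 3 * l + u)) + 0
                          ≡ 1 + 3 * suc l + s + (t + u + (t′ + u′))
    eq₁ = solve-∀
    eq₂ : ∀ u t s l v → v + (t + s + (l + u)) + 0 ≡ t + l + s + (u + v)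
    eq₂ = solve-∀

  record Consolidated (ts : List Tree) (m : Timed Heap) (N : ℕ) : Set κ where
    field
      wf     : All Wf (result m)
      cost   : time m ≤ 2 + 3 * length ts + rankBound N
      roots  : length (result m) ≤ rankBound N
      weight : ∀ c W → weighs c W (result m) ≤ weighs c W ts

  consolidated : ∀ {N} ts → All Wf ts → sizes ts ≤ N → Consolidated ts (consolidate ts) N
  consolidated {N} ts wfs ≤N with placeAll ts [] wfs []
  ... | sl , cost , weight = record
    { wf     = All-resp-↭ (↭-sym perm) (slots-wf sl)
    -- The surviving trees, counted as potential in the first loop, pay for the calls of `addRoot`
    -- in the second; beyond that the second loop costs only the number of slots.
    ; cost   = by-sum 0 (+-mono-≤ cost (+-mono-≤ (≤-reflexive (time-collect ss [])) ss≤))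
        (eq (time m₁) (time (forEach ss collect empty)) (length (trees ss)) (length ts)
            (length ss) (rankBound N))
    ; roots  = ≤-trans (≤-reflexive (↭-length perm)) (≤-trans (length-trees ss) ss≤)
    ; weight = λ c W → ≤-trans (≤-reflexive (weighs-↭ c W perm)) (weight′ c W)
    }
    where
    m₁ = forEach ts (λ t → placeAt (rank t) t) []
    ss = result m₁
    weight′ : ∀ c W → weighs c W (trees ss) ≤ weighs c W ts
    weight′ c W = ≤-trans (weight c W) (≤-reflexive (+-identityʳ _))
    perm : result (forEach ss collect empty) ↭ trees ss
    perm = ↭-trans (collect-↭ ss []) (↭-reflexive (++-identityʳ (trees ss)))
    ss≤ : length ss ≤ rankBound N
    ss≤ = slots-length≤rankBound sl (≤-trans (weight′ 0 (λ _ → 1)) ≤N)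
    eq : ∀ t₁ t₂ k l s B → t₁ + t₂ + (1 + 3 * l + 0 + (1 + s + k + B)) + 0
                         ≡ 2 + 3 * l + B + (t₁ + k + (t₂ + s))
    eq = solve-∀

  -- The 3 credits of a root pay for its share of the next consolidation.  A
  -- mark holds 4 credits: one for the cut and 3 for the root that arises.
  potential : (Fin n → ℕ) → Heap → ℕ
  potential W h = 3 * length h + weighs 4 W h

  HeapInv : ℕ → Heap → Set κ
  HeapInv N h = All Wf h × sizes h ≤ N

  siblings-all : ∀ ts → WfSiblings ts → All Wf ts
  siblings-all []       _              = []
  siblings-all (t ∷ ts) (wf , _ , wfs) = wf ∷ siblings-all ts wfs

  prependAll : List Tree → List Tree → Timed (List Tree)
  prependAll cs ts = forEach cs (λ t ts′ → return (t ∷ ts′)) ts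

  result-prependAll : ∀ cs ts → result (prependAll cs ts) ≡ cs ʳ++ ts
  result-prependAll []       ts = refl
  result-prependAll (c ∷ cs) ts = result-prependAll cs (c ∷ ts)

  time-prependAll : ∀ cs ts → time (prependAll cs ts) ≡ 1 + length cs
  time-prependAll []       ts = refl
  time-prependAll (c ∷ cs) ts = cong suc (time-prependAll cs (c ∷ ts))

  potentialAfter : (Fin n → ℕ) → Maybe (Fin n × Heap) → ℕ
  potentialAfter W nothing        = 0
  potentialAfter W (just (x , h)) = potential W h + W x

  extractMin-within : ∀ {N} W h → HeapInv N h →
                      Within (extractMin h) (Maybe.All (λ (_ , h′) → HeapInv N h′)) (potentialAfter W)
                             (8 * rankBound N + potential W h)
  extractMin-within W []                   (wfs , ≤N) = within Maybe.nothing (s≤s z≤n)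
  extractMin-within {N} W h@(node k x b cs ∷ ts) (wf-cs ∷ wfs , ≤N) = within
    (Maybe.just (wf cons , ≤-trans (weight cons 0 (λ _ → 1)) roots-≤N))
    -- The credits of the old roots pay for 3 units per old root. There remain 4 per child of the
    -- minimum, for moving and consolidating it, and 4 per slot, for reading it out and for the
    -- credits of a new root. Both counts are at most `rankBound N`, whence the 8. The slack is the
    -- mark of the extracted root.
    (by-sum (4 * bit b)
      (+-mono-≤ (≤-reflexive (time-prependAll cs ts)) (+-mono-≤ (cost cons)
        (+-mono-≤ (*-monoʳ-≤ 3 (roots cons)) (+-mono-≤ (weight cons 4 W)
        (+-mono-≤ (≤-reflexive (roots-weight 4 W))
        (+-mono-≤ (≤-reflexive (cong (3 *_) roots-length)) length-cs))))))
      (eq (time (prependAll cs ts)) (length cs) (length ts) (time (consolidate rs)) (length rs) (rankBound N)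
          (length (result (consolidate rs)))
          (weighs 4 W (result (consolidate rs))) (weighs 4 W rs) (weighs 4 W cs) (weighs 4 W ts)
          (W x) (4 * bit b)))
    where
    open Consolidated
    rs = result (prependAll cs ts)
    roots-weight : ∀ c W → weighs c W rs ≡ weighs c W cs + weighs c W ts
    roots-weight c W rewrite result-prependAll cs ts = weighs-ʳ++ c W cs ts
    roots-length : length rs ≡ length cs + length ts
    roots-length rewrite result-prependAll cs ts = length-ʳ++ cs
    roots-wf : All Wf rs
    roots-wf rewrite result-prependAll cs ts =
      All-resp-↭ (++↭ʳ++ cs ts) (++⁺ (siblings-all cs wf-cs) wfs)
    roots-≤N : sizes rs ≤ N
    roots-≤N = ≤-trans (≤-reflexive (roots-weight 0 (λ _ → 1)))
                       (≤-trans (n≤1+n _) ≤N)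
    cons = consolidated rs roots-wf roots-≤N
    length-cs : 4 * length cs ≤ 4 * rankBound N
    length-cs = *-monoʳ-≤ 4 (≤-trans (n≤1+n _) (fib⁺⁺≤⇒<rankBound {k = length cs}
      (≤-trans (fib⁺⁺-length≤sizes cs wf-cs) (≤-trans (m≤m+n _ _) ≤N))))
    eq : ∀ p c t u r M k w wr wc wt x f →
         p + (u + 0) + (3 * k + w + x)
         + (1 + c + (2 + 3 * r + M + (3 * M + (wr + (wc + wt + (3 * (c + t) + 4 * M))))))
         + f
         ≡ 8 * M + (3 * suc t + (x + f + wc + wt)) + (p + (u + (3 * k + (w + (wr + (3 * r + 4 * c))))))
    eq = solve-∀

  -- Cascading cuts and decrease-key.

  record Cut (f : Frame) (fs : List Frame) (t : Tree) (m : Timed (List Tree × Tree)) : Set κ where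
    cuts = proj₁ (result m)
    rest = proj₂ (result m)
    field
      wf-cuts : All Wf cuts
      wf-rest : Wf rest
      cost    : time m ≡ 1 + length cuts
      -- Each subtree in `cuts` gives back the weight `c` of its mark. The ancestor at which the
      -- cascade stops may receive a mark, whence the `c` on the right; `t` is the child already
      -- detached.
      weight  : ∀ c W → weighs c W cuts + weigh c W rest + c * length cuts + weigh c W t
                      ≤ weigh c W (plug t (f ∷ fs)) + c

  cascadingCut-cut : ∀ t f fs → Wf (plug t (f ∷ fs)) → Cut f fs t (cascadingCut f fs)
  cascadingCut-cut t (frame k x b ls rs) [] wf = record
    { wf-cuts = []
    ; wf-rest = siblings-remove ls wf
    ; cost    = refl
    -- A root receives no mark, so `c` is left over.
    ; weight  = λ c W → by-sum c
        (≤-reflexive (cong₂ _+_ (weighs-ʳ++ c W ls rs) (sym (weighs-ʳ++ c W ls (t ∷ rs)))))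
        (eq (W x) c (bit b) (weighs c W (ls ʳ++ rs)) (weighs c W (ls ʳ++ t ∷ rs))
            (weighs c W ls) (weighs c W rs) (weigh c W t))
    }
    where
    eq : ∀ x c b q q′ l r t →
         0 + (x + c * b + q) + c * 0 + t + (l + r + q′) + c
         ≡ x + c * b + q′ + c + (q + (l + (t + r)))
    eq = solve-∀
  cascadingCut-cut t (frame k x false ls rs) (f ∷ fs) wf = record
    { wf-cuts = []
    -- One child fewer and one mark more: the slack stays the same.
    ; wf-rest = wf-refocus (f ∷ fs) (siblings-remove ls (wf-focus (f ∷ fs) wf)) (≤-reflexive lengths) wf
    ; cost    = refl
    ; weight  = λ c W → ≤-reflexive (trans
        (cong (λ w → 0 + w + c * 0 + weigh c W t) (trans (weigh-plug c W _ (f ∷ fs))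
          (cong (λ w → W x + c * 1 + w + weighPath c W (f ∷ fs)) (weighs-ʳ++ c W ls rs))))
        (trans (eq (W x) c (weighs c W ls) (weighs c W rs) (weigh c W t) (weighPath c W (f ∷ fs)))
          (sym (cong (_+ c) (weigh-plug c W t (frame k x false ls rs ∷ f ∷ fs))))))
    }
    where
    lengths : length (ls ʳ++ t ∷ rs) ≡ suc (length (ls ʳ++ rs))
    lengths = trans (length-ʳ++ ls)
      (trans (+-suc (length ls) (length rs)) (cong suc (sym (length-ʳ++ ls))))
    eq : ∀ x c l r t p → 0 + (x + c * 1 + (l + r) + p) + c * 0 + t ≡ t + (x + c * 0 + (l + r) + p) + c
    eq = solve-∀
  cascadingCut-cut t (frame k x true ls rs) (f ∷ fs) wf = record
    { wf-cuts = siblings-remove ls (wf-focus (f ∷ fs) wf) ∷ Cut.wf-cuts ih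
    ; wf-rest = Cut.wf-rest ih
    ; cost    = cong suc (trans (+-identityʳ _) (Cut.cost ih))
    ; weight  = λ c W → by-sum 0
        (+-mono-≤ (Cut.weight ih c W)
          (≤-reflexive (cong₂ _+_ (weighs-ʳ++ c W ls rs) (sym (weighs-ʳ++ c W ls (t ∷ rs))))))
        (eq (W x) c (weighs c W (ls ʳ++ rs)) (weighs c W (ls ʳ++ t ∷ rs))
            (weighs c W ls) (weighs c W rs) (weigh c W t)
            (weighs c W (Cut.cuts ih)) (weigh c W (Cut.rest ih)) (length (Cut.cuts ih))
            (weigh c W (plug parent (f ∷ fs))))
    }
    where
    parent = node k x true (ls ʳ++ t ∷ rs)
    -- The next ancestor loses the whole of `parent`, with `t` still in it; the identity then splits
    -- `parent` into `t` and the subtree cut off.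
    ih = cascadingCut-cut parent f fs wf
    eq : ∀ x c q q′ l r t u v j P →
         (x + c * 0 + q) + u + v + c * suc j + t + (P + c + (l + r + q′)) + 0
         ≡ P + c + (u + v + c * j + (x + c * 1 + q′) + (q + (l + (t + r))))
    eq = solve-∀

  spliceRoots-↭ : ∀ us h → spliceRoots us h ↭ us ++ h
  spliceRoots-↭ us []       = ↭-reflexive (sym (++-identityʳ us))
  spliceRoots-↭ us (m ∷ ts) = ↭-sym (shift m us ts)

  roots : Position → Heap
  roots (position t fs ls rs) = ls ʳ++ plug t fs ∷ rs

  refocus-↭ : ∀ ls (t : Tree) rs → ls ʳ++ t ∷ rs ↭ t ∷ ls ++ rs
  refocus-↭ ls t rs = ↭-trans (↭-sym (++↭ʳ++ ls (t ∷ rs))) (shift t ls rs)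

  record Decreased (h : Heap) (m : Timed Heap) : Set κ where
    field
      wf      : All Wf (result m)
      cuts    : ℕ
      cost    : time m ≤ 3 + cuts
      length≤ : length (result m) ≤ length h + suc cuts
      weight  : ∀ c W → weighs c W (result m) + c * cuts ≤ weighs c W h + c

  -- Common to the three cases of `decreaseAt` without a cut, in which one root tree changes nothing
  -- but a key.
  rekeyed : ∀ {h t ts m} → h ↭ t ∷ ts → All Wf h → ∀ u → result m ↭ u ∷ ts → (Wf t → Wf u) →
            (∀ c W → weigh c W u ≡ weigh c W t) → time m ≤ 3 → Decreased h m
  rekeyed {h} {t} {ts} {m} h↭ wfs u m↭ wf-u weigh-u cost with All-resp-↭ h↭ wfs
  ... | wf-t ∷ wf-ts = record
    { wf      = All-resp-↭ (↭-sym m↭) (wf-u wf-t ∷ wf-ts)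
    ; cuts    = 0
    ; cost    = cost
    ; length≤ = ≤-trans (≤-reflexive (trans (↭-length m↭) (sym (↭-length h↭)))) (m≤m+n _ 1)
    ; weight  = λ c W → ≤-trans
        (≤-reflexive (cong₂ _+_
          (trans (weighs-↭ c W m↭) (trans (cong (_+ weighs c W ts) (weigh-u c W)) (sym (weighs-↭ c W h↭))))
          (*-zeroʳ c)))
        (+-monoʳ-≤ (weighs c W h) z≤n)
    }

  decreaseAt-decreased : ∀ k p → All Wf (roots p) → Decreased (roots p) (decreaseAt k p)
  decreaseAt-decreased k (position (node l x b cs) [] [] rs) wfs =
    rekeyed refl wfs (node k x b cs) refl (λ wf → wf) (λ c W → refl) (s≤s z≤n)
  decreaseAt-decreased k (position (node l x b cs) [] ls@(_ ∷ _) rs) wfs =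
    rekeyed (refocus-↭ ls (node l x b cs) rs) wfs (node k x b cs)
      (↭-trans (addRoot-↭ (node k x b cs) (ls ʳ++ rs)) (prep _ (↭-sym (++↭ʳ++ ls rs))))
      (λ wf → wf) (λ c W → refl)
      (≤-trans (≤-reflexive (time-addRoot (node k x b cs) (ls ʳ++ rs))) (s≤s z≤n))
  decreaseAt-decreased k (position (node l x b cs) (f ∷ fs) ls rs) wfs with does (Frame.k f ≼? k)
  ... | true = rekeyed (refocus-↭ ls (plug t (f ∷ fs)) rs) wfs (plug u (f ∷ fs))
      (refocus-↭ ls (plug u (f ∷ fs)) rs)
      (λ wf → wf-refocus (f ∷ fs) (wf-focus (f ∷ fs) wf) ≤-refl wf)
      (λ c W → trans (weigh-plug c W u (f ∷ fs)) (sym (weigh-plug c W t (f ∷ fs))))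
      (s≤s z≤n)
      where
      t = node l x b cs
      u = node k x b cs
  ... | false with All-resp-↭ (refocus-↭ ls (plug (node l x b cs) (f ∷ fs)) rs) wfs
  ... | wf-tree ∷ wf-others = record
    { wf      = All-resp-↭ (↭-sym m↭)
        (wf-focus (f ∷ fs) wf-tree ∷ ++⁺ (Cut.wf-cuts cut) (Cut.wf-rest cut ∷ wf-others))
    ; cuts    = j
    -- One comparison, `1 + j` for the cascade and one `addRoot`.
    ; cost    = ≤-reflexive (trans
        (cong₂ (λ a b → 1 + (a + b)) (Cut.cost cut) (time-addRoot u spliced))
        (cong (2 +_) (+-comm j 1)))
    ; length≤ = ≤-reflexive (trans (↭-length m↭) (trans (cong suc (length-++ (Cut.cuts cut)))
        (trans (eq₁ j (length (ls ++ rs))) (cong (_+ suc j) (sym (↭-length h↭))))))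
    -- The slack is the mark of the node itself, cleared when it becomes a root.
    ; weight  = λ c W → by-sum (c * bit b) (+-mono-≤ (Cut.weight cut c W)
          (≤-reflexive (cong₂ _+_
            (trans (weighs-↭ c W m↭) (cong (weigh c W u +_) (weighs-++ c W (Cut.cuts cut) _)))
            (sym (weighs-↭ c W h↭)))))
        (eq₂ (weighs c W (result (addRoot u spliced))) (weighs c W (ls ʳ++ plug t (f ∷ fs) ∷ rs))
             (W x) c (bit b) (weighs c W cs) (weighs c W (Cut.cuts cut)) (weigh c W (Cut.rest cut)) j
             (weighs c W (ls ++ rs)) (weigh c W (plug t (f ∷ fs))))
    }
    where
    t = node l x b cs
    u = node k x false cs
    cut = cascadingCut-cut t f fs wf-tree
    j = length (Cut.cuts cut)
    h↭ = refocus-↭ ls (plug t (f ∷ fs)) rs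
    spliced = spliceRoots (Cut.cuts cut) (ls ʳ++ Cut.rest cut ∷ rs)
    m↭ : result (addRoot u spliced)
         ↭ u ∷ Cut.cuts cut ++ Cut.rest cut ∷ (ls ++ rs)
    m↭ = ↭-trans (addRoot-↭ u _) (prep u (↭-trans (spliceRoots-↭ (Cut.cuts cut) _)
           (++⁺ˡ (Cut.cuts cut) (refocus-↭ ls (Cut.rest cut) rs))))
    eq₁ : ∀ j l → suc (j + suc l) ≡ suc l + suc j
    eq₁ = solve-∀
    eq₂ : ∀ m h x c b cs v r j o P →
          m + c * j + (P + c + (x + c * 0 + cs + (v + (r + o)) + h)) + c * b
          ≡ h + c + (v + r + c * j + (x + c * b + cs) + (m + (P + o)))
    eq₂ = solve-∀

  mutual
    -- The search is a zipper: each step moves material between focus and path, and plugging undoes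
    -- it.
    plug-locateInTree : ∀ x t fs {u gs} → locateInTree x t fs ≡ just (u , gs) → plug u gs ≡ plug t fs
    plug-locateInTree x (node k y b cs) fs eq with does (x ≟ y) | eq
    ... | true  | refl = refl
    ... | false | eq′  = plug-locateInChildren x k y b [] cs fs eq′

    plug-locateInChildren : ∀ x k y b ls rs fs {u gs} →
                            locateInChildren x k y b ls rs fs ≡ just (u , gs) →
                            plug u gs ≡ plug (node k y b (ls ʳ++ rs)) fs
    plug-locateInChildren x k y b ls (t ∷ rs) fs eq
      with locateInTree x t (frame k y b ls rs ∷ fs) in eq′ | eq
    ... | just _  | refl = plug-locateInTree x t (frame k y b ls rs ∷ fs) eq′
    ... | nothing | eq″  = plug-locateInChildren x k y b (t ∷ ls) rs fs eq″

  roots-locate : ∀ x ls ts {p} → locate x ls ts ≡ just p → roots p ≡ ls ʳ++ ts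
  roots-locate x ls (t ∷ ts) eq with locateInTree x t [] in eq′ | eq
  ... | just _  | refl = cong (λ u → ls ʳ++ u ∷ ts) (plug-locateInTree x t [] eq′)
  ... | nothing | eq″  = roots-locate x (t ∷ ls) ts eq″

  decreaseKey-within : ∀ {N} W x k h → HeapInv N h →
                       Within (decreaseKey x k h) (HeapInv N) (potential W) (11 + potential W h)
  decreaseKey-within W x k h inv with locate x [] h in eq
  ... | nothing = within inv (s≤s (m≤n+m _ 10))
  decreaseKey-within W x k h (wfs , ≤N) | just p with roots-locate x [] h eq
  ... | refl = within
    ( D.wf
    , ≤-trans (by-sum 0 (D.weight 0 (λ _ → 1))
                        (eq₁ (sizes (result (decreaseAt k p))) (sizes (roots p)))) ≤N )
    -- The 11 is 1 for locating the node, 3 for the fixed part of `cost`, 3 for the credits of the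
    -- new root and 4 for a new mark. Each cascaded cut costs 1 and creates a root with 3 credits,
    -- which its released mark covers.
    (by-sum 0 (+-mono-≤ D.cost (+-mono-≤ (*-monoʳ-≤ 3 length≤) (D.weight 4 W)))
      (eq₂ (time (decreaseAt k p)) cuts (length (result (decreaseAt k p))) (length (roots p))
        (weighs 4 W (result (decreaseAt k p))) (weighs 4 W (roots p))))
    where
    open module D = Decreased (decreaseAt-decreased k p wfs) using (cuts; length≤)
    eq₁ : ∀ s t → s + (t + 0) + 0 ≡ t + (s + 0)
    eq₁ = solve-∀
    eq₂ : ∀ t j l h w v →
          suc t + (3 * l + w) + (3 + j + (3 * (h + suc j) + (v + 4))) + 0
          ≡ 11 + (3 * h + v) + (t + (3 * l + (w + 4 * j)))
    eq₂ = solve-∀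

-- Sums and counts over finite sets.

∑-allFin : ∀ {n} (f : Fin (suc n) → ℕ) → ∑ (allFin (suc n)) f ≡ f zero + ∑ (allFin n) (λ i → f (suc i))
∑-allFin {n} f = cong (λ xs → f zero + sum xs)
  (trans (map-tabulate suc f) (sym (map-tabulate id (f ∘ suc))))

∑-allFin-const : ∀ n c → ∑ (allFin n) (λ _ → c) ≡ n * c
∑-allFin-const n c = trans (∑-const c (allFin n)) (cong (_* c) (length-tabulate {n = n} id))

length≡∑ : ∀ {a} {A : Set a} (xs : List A) → length xs ≡ ∑ xs (λ _ → 1)
length≡∑ xs = sym (trans (∑-const 1 xs) (*-identityʳ (length xs)))

length-filter≡∑ : ∀ {a p} {A : Set a} {P : Pred A p} (P? : Decidable P) xs →
                  length (filter P? xs) ≡ ∑ xs (λ x → if does (P? x) then 1 else 0)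
length-filter≡∑ P? xs = trans (length≡∑ (filter P? xs)) (∑-filter P? (λ _ → 1) xs)

length-members : ∀ {n} (p : Subset n) → length (filter (_∈? p) (allFin n)) ≡ ∣ p ∣
length-members {n} p = trans (length-filter≡∑ (_∈? p) (allFin n)) (go p)
  where
  go : ∀ {n} (p : Subset n) → ∑ (allFin n) (λ v → if does (v ∈? p) then 1 else 0) ≡ ∣ p ∣
  go []          = refl
  go (true  ∷ p) = trans (∑-allFin (λ v → if does (v ∈? (true ∷ p)) then 1 else 0)) (cong suc (go p))
  go (false ∷ p) = trans (∑-allFin (λ v → if does (v ∈? (false ∷ p)) then 1 else 0)) (go p)

∑-length-update : ∀ {a} {A : Set a} {n} (xss : Vec (List A) n) u x →
                  ∑ (allFin n) (λ v → length (lookup (xss [ u ]≔ (x ∷ lookup xss u)) v))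
                  ≡ suc (∑ (allFin n) (λ v → length (lookup xss v)))
∑-length-update (xs ∷ xss) zero x =
  trans (∑-allFin (λ v → length (lookup ((x ∷ xs) ∷ xss) v)))
          (cong suc (sym (∑-allFin (λ v → length (lookup (xs ∷ xss) v)))))
∑-length-update {n = suc n} (xs ∷ xss) (suc u) x = begin
  ∑ (allFin (suc n)) (λ v → length (lookup (xs ∷ xss [ u ]≔ (x ∷ lookup xss u)) v))
    ≡⟨ ∑-allFin (λ v → length (lookup (xs ∷ xss [ u ]≔ (x ∷ lookup xss u)) v)) ⟩
  length xs + ∑ (allFin n) (λ v → length (lookup (xss [ u ]≔ (x ∷ lookup xss u)) v))
    ≡⟨ cong (length xs +_) (∑-length-update xss u x) ⟩
  length xs + suc (∑ (allFin n) (λ v → length (lookup xss v)))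
    ≡⟨ +-suc (length xs) _ ⟩
  suc (length xs + ∑ (allFin n) (λ v → length (lookup xss v)))
    ≡⟨ cong suc (∑-allFin (λ v → length (lookup (xs ∷ xss) v))) ⟨
  suc (∑ (allFin (suc n)) (λ v → length (lookup (xs ∷ xss) v))) ∎
  where open ≡-Reasoning

nonempty⇒0<∣p∣ : ∀ {n} (p : Subset n) → Nonempty p → 0 < ∣ p ∣
nonempty⇒0<∣p∣ p (x , x∈p) = ≤-trans (≤-reflexive (sym (∣⁅x⁆∣≡1 x))) (p⊆q⇒∣p∣≤∣q∣ ⁅x⁆⊆p)
  where
  ⁅x⁆⊆p : ⁅ x ⁆ ⊆ p
  ⁅x⁆⊆p y∈ rewrite x∈⁅y⁆⇒x≡y x y∈ = x∈p

k≤k² : ∀ k → k ≤ k ^ 2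
k≤k² zero    = z≤n
k≤k² (suc k) = m≤m*n (suc k) (suc k * 1)

∑-downFrom-single : ∀ j c k → ∑ (downFrom k) (λ i → if does (j ≟ℕ i) then c else 0) ≤ c
∑-downFrom-single j c zero    = z≤n
-- The Boolean of `j ≟ℕ k` computes to `j ≡ᵇ k`, so abstracting the latter reduces the summand.
-- After a match, `beyond` shows that all smaller indices contribute 0.
∑-downFrom-single j c (suc k) with j ≡ᵇ k | ≡ᵇ⇒≡ j k
... | false | _   = ∑-downFrom-single j c k
... | true  | j≡k = ≤-reflexive (trans (cong (c +_) (beyond k (≤-reflexive (sym (j≡k tt))))) (+-identityʳ c))
  where
  beyond : ∀ k → k ≤ j → ∑ (downFrom k) (λ i → if does (j ≟ℕ i) then c else 0) ≡ 0
  beyond zero    k≤j = refl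
  beyond (suc k) k<j with j ≡ᵇ k | ≡ᵇ⇒≡ j k
  ... | false | _   = beyond k (<⇒≤ k<j)
  ... | true  | j≡k = contradiction (j≡k tt) (>⇒≢ k<j)

-- The algorithms

module AlgorithmAnalysis {c ℓ₁ ℓ₂ : Level} {K : Scalars c ℓ₁ ℓ₂} (H : Hypergraph K) where

  open Scalars K using (Carrier; 0ˢ)
  open Hypergraph H
  open Algorithms H
  open HeapAnalysis _≤∞?_ ∣V∣

  StateInv : State → Set c
  StateInv st = HeapInv ∣V∣ (State.heap st)

  potentialˢ : (Vertex → ℕ) → State → ℕ
  potentialˢ W st = potential W (State.heap st)

  -- The 5 is one write, one `addRoot` and the three credits of a new root.
  initialise-within : ∀ W s → Within (initialise s) StateInv (potentialˢ W)
                                     (1 + ∑ (allFin ∣V∣) (λ v → 1 + (5 + W v)))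
  initialise-within W s = within
    (proj₁ (post initial) , ≤-trans (≤-reflexive (sym (+-identityʳ _))) (proj₂ (post initial)))
    (≤-trans (bound initial) (≤-reflexive (+-identityʳ _)))
    where
    -- Counting the vertices still to be inserted makes the size bound inductive.
    Inserting : List Vertex → State → Set c
    Inserting vs st = All Wf (State.heap st) × sizes (State.heap st) + length vs ≤ ∣V∣

    initialDistance : Vertex → Distance
    initialDistance v = if does (v ≟ s) then [ 0ˢ ] else ⊤⁺

    insert-within : ∀ {vs} v d h → All Wf h → sizes h + suc (length vs) ≤ ∣V∣ →
                    Within (insert v d h)
                           (λ h′ → All Wf h′ × sizes h′ + length vs ≤ ∣V∣)
                           (potential W) (4 + W v + potential W h)
    insert-within {vs} v d h wfs ≤V = within
      ( All-resp-↭ (↭-sym h↭) (tt ∷ wfs)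
      , ≤-trans (≤-reflexive (trans (cong (_+ length vs) (weighs-↭ 0 (λ _ → 1) h↭))
                                    (sym (+-suc (sizes h) (length vs))))) ≤V )
      (≤-reflexive (trans
        (cong₂ (λ t l → t + (3 * l + weighs 4 W (result (insert v d h)))) (time-addRoot _ h) (↭-length h↭))
        (trans (cong (λ w → 1 + (3 * suc (length h) + w)) (weighs-↭ 4 W h↭))
               (eq (length h) (W v) (weighs 4 W h)))))
      where
      h↭ = addRoot-↭ (node d v false []) h
      eq : ∀ l x w → 1 + (3 * suc l + (x + 4 * 0 + 0 + w)) ≡ 4 + x + (3 * l + w)
      eq = solve-∀

    initial = forEach-within Inserting (potentialˢ W) (λ v → 5 + W v)
      (λ {v} {vs} {st} (wfs , ≤V) → spend 1 (bind-within {d = 0}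
        (insert-within {vs} v (initialDistance v) (State.heap st) wfs ≤V) (λ inv → within inv ≤-refl)))
      (allFin ∣V∣) (state (replicate ∣V∣ ⊤⁺) (replicate ∣V∣ nothing) empty)
      ([] , ≤-reflexive (length-tabulate id))

  -- The 17 is 6 for reads, arithmetic, comparison and writes, and 11 for decrease-key.
  relax-within : ∀ W z v x e st → StateInv st →
                 Within (relax z v x e st) StateInv (potentialˢ W) (17 + potentialˢ W st)
  relax-within W z v x e (state D pred h) inv with does (lookup D v ≤∞? (lookup D z plus x))
  ... | true  = within inv (+-monoˡ-≤ (potential W h) {4} {17} (s≤s (s≤s (s≤s (s≤s z≤n)))))
  ... | false = spend 6 (bind-within {d = 0}
    (decreaseKey-within W v (lookup D z plus x) h inv) (λ inv → within inv ≤-refl))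

  -- The budget `W z` is exactly what the extraction of `z` releases.
  Scans : (Vertex → ℕ) → (Vertex → State → Timed State) → Set c
  Scans W scan = ∀ z st → StateInv st → Within (scan z st) StateInv (potentialˢ W) (W z + potentialˢ W st)

  fixVertices-within : ∀ W {scan} → Scans W scan → ∀ fuel st → StateInv st →
                       Within (fixVertices scan fuel st) (λ _ → ⊤) (λ _ → 0)
                              (fuel * (8 * rankBound ∣V∣) + potentialˢ W st)
  fixVertices-within W scans zero       st               inv = within tt z≤n
  fixVertices-within W scans (suc fuel) (state D pred []) inv = within tt (s≤s z≤n)
  fixVertices-within W {scan} scans (suc fuel) (state D pred h@(node _ z _ _ ∷ _)) inv
    with extractMin-within W h inv
  ... | within (Maybe.just inv′) b = within tt
    (by-sum 0 (+-mono-≤ b (+-mono-≤ (bound scanned) (bound fixed)))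
      (eq (time (extractMin h)) _ (W z) fuel (8 * rankBound ∣V∣) (potential W h)
          (time (scan z st)) (potentialˢ W (result (scan z st)))
          (time (fixVertices scan fuel (result (scan z st))))))
    where
    st = state D pred _
    scanned = scans z st inv′
    fixed = fixVertices-within W scans fuel (result (scan z st)) (post scanned)
    eq : ∀ tₑ p′ w f b p tₛ pₛ t →
         tₑ + (tₛ + t) + 0 + (b + p + (w + p′ + (f * b + pₛ))) + 0
         ≡ b + f * b + p + (tₑ + (p′ + w) + (tₛ + pₛ + (t + 0)))
    eq = solve-∀

  nlogn : ℕ
  nlogn = ∣V∣ * ⌊log₂ ∣V∣ ⌋

  -- A vertex costs 6 on insertion, loop step included, and `8 * rankBound ∣V∣`, that is 16 + 16 log
  -- n, on extraction.
  time-labelSetting : ∀ W {scan} → Scans W scan → ∀ s →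
                      time (labelSetting scan s) ≤ 1 + 22 * ∣V∣ + 16 * nlogn + ∑ (allFin ∣V∣) W
  time-labelSetting W {scan} scans s = begin
    time (labelSetting scan s)
      ≡⟨ +-identityʳ _ ⟨
    time (labelSetting scan s) + 0
      ≤⟨ bound (bind-within {f = fixVertices scan ∣V∣} (initialise-within W s)
                            λ {st} → fixVertices-within W scans ∣V∣ st) ⟩
    ∣V∣ * (8 * (2 + 2 * ⌊log₂ ∣V∣ ⌋)) + (1 + ∑ (allFin ∣V∣) (λ v → 6 + W v))
      ≡⟨ cong (λ x → ∣V∣ * (8 * (2 + 2 * ⌊log₂ ∣V∣ ⌋)) + (1 + x))
           (trans (∑-+ (λ _ → 6) W (allFin ∣V∣)) (cong (_+ ∑ (allFin ∣V∣) W) (∑-allFin-const ∣V∣ 6))) ⟩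
    ∣V∣ * (8 * (2 + 2 * ⌊log₂ ∣V∣ ⌋)) + (1 + (∣V∣ * 6 + ∑ (allFin ∣V∣) W))
      ≡⟨ eq ∣V∣ ⌊log₂ ∣V∣ ⌋ (∑ (allFin ∣V∣) W) ⟩
    1 + 22 * ∣V∣ + 16 * nlogn + ∑ (allFin ∣V∣) W  ∎
    where
    open ≤-Reasoning
    eq : ∀ n l w → n * (8 * (2 + 2 * l)) + (1 + (n * 6 + w)) ≡ 1 + 22 * n + 16 * (n * l) + w
    eq = solve-∀

  -- Gallo's algorithm.

  length-verticesOf : ∀ e → length (verticesOf e) ≡ ∣ edge e ∣
  length-verticesOf e = length-members (edge e)

  -- Double counting of the incidences of `z` and `e`: both filters become the same indicator in a
  -- sum over all pairs.
  edgesAt-swap : ∀ f → ∑ (allFin ∣V∣) (λ z → ∑ (edgesAt z) f) ≡ ∑ (allFin ∣E∣) (λ e → ∣ edge e ∣ * f e)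
  edgesAt-swap f = begin
    ∑ Vs (λ z → ∑ (edgesAt z) f)
      ≡⟨ ∑-cong (λ z → ∑-filter (λ e → z ∈? edge e) f Es) Vs ⟩
    ∑ Vs (λ z → ∑ Es (λ e → if does (z ∈? edge e) then f e else 0))
      ≡⟨ ∑-swap _ Vs Es ⟩
    ∑ Es (λ e → ∑ Vs (λ z → if does (z ∈? edge e) then f e else 0))
      ≡⟨ ∑-cong (λ e → ∑-filter (_∈? edge e) (λ _ → f e) Vs) Es ⟨
    ∑ Es (λ e → ∑ (verticesOf e) (λ _ → f e))
      ≡⟨ ∑-cong (λ e → trans (∑-const (f e) (verticesOf e)) (cong (_* f e) (length-verticesOf e))) Es ⟩
    ∑ Es (λ e → ∣ edge e ∣ * f e) ∎
    where
    open ≡-Reasoning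
    Vs = allFin ∣V∣
    Es = allFin ∣E∣

  galloWeight : Vertex → ℕ
  galloWeight z = 1 + ∑ (edgesAt z) λ e → 1 + (1 + ∑ (verticesOf e) λ v → 1 + 17)

  gallo-scans : Scans galloWeight
                (λ z → forEach (edgesAt z) λ e → forEach (verticesOf e) λ v → relax z v (w e) e)
  gallo-scans z st inv =
    forEach-within (λ _ → StateInv) _ _
      (λ {e} {_} {st} inv → forEach-within (λ _ → StateInv) _ _
        (λ {v} {_} {st} inv → relax-within galloWeight z v (w e) e st inv) (verticesOf e) st inv)
      (edgesAt z) st inv

  ∑-galloWeight : ∑ (allFin ∣V∣) galloWeight ≤ ∣V∣ + 20 * Φ
  ∑-galloWeight = begin
    ∑ (allFin ∣V∣) galloWeight
      ≡⟨ ∑-+ (λ _ → 1) _ (allFin ∣V∣) ⟩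
    ∑ (allFin ∣V∣) (λ _ → 1) + ∑ (allFin ∣V∣) (λ z → ∑ (edgesAt z) f)
      ≡⟨ cong₂ _+_ (trans (∑-allFin-const ∣V∣ 1) (*-identityʳ ∣V∣)) (edgesAt-swap f) ⟩
    ∣V∣ + ∑ (allFin ∣E∣) (λ e → ∣ edge e ∣ * f e)
      ≤⟨ +-monoʳ-≤ ∣V∣ (∑-mono f≤ (allFin ∣E∣)) ⟩
    ∣V∣ + ∑ (allFin ∣E∣) (λ e → 20 * ∣ edge e ∣ ^ 2)
      ≡⟨ cong (∣V∣ +_) (∑-* 20 (λ e → ∣ edge e ∣ ^ 2) (allFin ∣E∣)) ⟩
    ∣V∣ + 20 * Φ ∎
    where
    open ≤-Reasoning
    f : Edge → ℕ
    f e = 1 + (1 + ∑ (verticesOf e) λ v → 18)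
    eq : ∀ k → k * (2 + k * 18) + 2 * (k * (k * 1)) + 0 ≡ 20 * (k * (k * 1)) + 2 * k
    eq = solve-∀
    f≤ : ∀ e → ∣ edge e ∣ * f e ≤ 20 * ∣ edge e ∣ ^ 2
    f≤ e rewrite ∑-const 18 (verticesOf e) | length-verticesOf e =
      by-sum 0 (*-monoʳ-≤ 2 (k≤k² ∣ edge e ∣)) (eq ∣ edge e ∣)

  time-gallo : ∀ s → time (gallo s) ≤ 1 + 23 * ∣V∣ + 16 * nlogn + 20 * Φ
  time-gallo s = by-sum 0 (+-mono-≤ (time-labelSetting galloWeight gallo-scans s) ∑-galloWeight)
    (eq (time (gallo s)) ∣V∣ nlogn (∑ (allFin ∣V∣) galloWeight) Φ)
    where
    eq : ∀ t n l w p → t + (1 + 22 * n + 16 * l + w + (n + 20 * p)) + 0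
                     ≡ 1 + 23 * n + 16 * l + 20 * p + (t + w)
    eq = solve-∀

  -- The underlying graph and Dijkstra's algorithm.

  degreeSum : Graph → ℕ
  degreeSum (graph N _) = ∑ (allFin ∣V∣) (λ v → length (lookup N v))

  -- Each entry of an adjacency list stores what Dijkstra's algorithm will spend on it: 1 for the
  -- loop, 2 for reading the weight and 17 for the relaxation.
  graphPotential : Graph → ℕ
  graphPotential G = 20 * degreeSum G

  -- A new pair takes 12 units of time and creates two adjacency entries with 20 credits each.
  lend-within : ∀ l u v G → Within (lend l u v G) (λ _ → ⊤) graphPotential (52 + graphPotential G)
  lend-within l u v (graph N W) with lookup (lookup W u) v
  ... | just _  = within tt (+-monoˡ-≤ (graphPotential (graph N W)) {9} {52} (m≤m+n 9 43))
  ... | nothing = within tt (≤-reflexive (trans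
    (cong (λ d → 12 + 20 * d) (trans (∑-length-update (N [ u ]≔ (v ∷ lookup N u)) v u)
                                       (cong suc (∑-length-update N u v))))
    (eq (degreeSum (graph N W)))))
    where
    eq : ∀ d → 12 + 20 * suc (suc d) ≡ 52 + 20 * d
    eq = solve-∀

  pairCost : ℕ → ℕ
  pairCost zero    = 1
  pairCost (suc k) = 1 + (1 + k * 53) + pairCost k

  pairCost≤ : ∀ k → pairCost k ≤ 1 + 53 * k ^ 2
  pairCost≤ zero    = ≤-refl
  pairCost≤ (suc k) = by-sum (53 * k + 51) (pairCost≤ k) (eq k (pairCost k))
    where
    eq : ∀ k p → 1 + (1 + k * 53) + p + (1 + 53 * (k * (k * 1))) + (53 * k + 51)
               ≡ 1 + 53 * (suc k * (suc k * 1)) + p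
    eq = solve-∀

  lendToPairs-within : ∀ l us G → Within (lendToPairs l us G) (λ _ → ⊤) graphPotential
                                         (pairCost (length us) + graphPotential G)
  lendToPairs-within l []       G = within tt ≤-refl
  lendToPairs-within l (u ∷ us) G = weaken
    (spend 1 (bind-within {d = pairCost (length us)}
      (forEach-within (λ _ _ → ⊤) graphPotential (λ _ → 52) (λ {v} {_} {G} _ → lend-within l u v G) us G tt)
      λ {G′} _ → lendToPairs-within l us G′))
    (≤-reflexive (trans (cong (λ x → 1 + (pairCost (length us) + (1 + x + graphPotential G))) (∑-const 53 us))
                          (eq (pairCost (length us)) (length us * 53) (graphPotential G))))
    where
    eq : ∀ p x g → 1 + (p + (1 + x + g)) ≡ 1 + (1 + x) + p + g
    eq = solve-∀

  degreeSum-noEdges : graphPotential (result noEdges) ≡ 0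
  degreeSum-noEdges = cong (20 *_) (trans
    (∑-cong (λ v → cong length (lookup-replicate v [])) (allFin ∣V∣))
    (trans (∑-allFin-const ∣V∣ 0) (*-zeroʳ ∣V∣)))

  noEdges-within : Within noEdges (λ _ → ⊤) graphPotential 0
  noEdges-within = within tt (≤-reflexive degreeSum-noEdges)

  0<∣edge∣ : ∀ e → 0 < ∣ edge e ∣
  0<∣edge∣ e = nonempty⇒0<∣p∣ (edge e) (edge-nonempty e)

  underlyingGraph-within : Within underlyingGraph (λ _ → ⊤) graphPotential (1 + 55 * Φ)
  underlyingGraph-within = weaken
    (bind-within {d = 1 + ∑ (allFin ∣E∣) cost} noEdges-within λ {G} _ →
      forEach-within (λ _ _ → ⊤) graphPotential (λ e → pairCost (length (verticesOf e)))
        (λ {e} {_} {G} _ → lendToPairs-within (w e , e) (verticesOf e) G) (allFin ∣E∣) G tt)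
    (≤-trans (≤-reflexive (+-identityʳ _)) (s≤s (≤-trans (∑-mono cost≤ (allFin ∣E∣))
      (≤-reflexive (∑-* 55 (λ e → ∣ edge e ∣ ^ 2) (allFin ∣E∣))))))
    where
    cost : Edge → ℕ
    cost e = 1 + pairCost (length (verticesOf e))
    eq : ∀ k p q → 1 + p + (1 + 53 * q + 2 * k + 2 * q) + 0
                 ≡ 55 * q + (p + 2 * 1 + 2 * k)
    eq = solve-∀
    cost≤ : ∀ e → cost e ≤ 55 * ∣ edge e ∣ ^ 2
    cost≤ e rewrite length-verticesOf e =
      by-sum 0
        (+-mono-≤ (+-mono-≤ (pairCost≤ ∣ edge e ∣) (*-monoʳ-≤ 2 (0<∣edge∣ e)))
                  (*-monoʳ-≤ 2 (k≤k² ∣ edge e ∣)))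
        (eq ∣ edge e ∣ (pairCost ∣ edge e ∣) (∣ edge e ∣ ^ 2))

  dijkstraWeight : Graph → Vertex → ℕ
  dijkstraWeight (graph N _) z = 2 + length (lookup N z) * 20

  -- The loop body of Dijkstra's algorithm is local to its definition, and is
  -- recovered here by unification, so that it can be mentioned in a type.
  dijkstra-loop : ∀ N W → ∃ λ (body : Vertex → Vertex → State → Timed State) → ∀ s →
                  dijkstra (graph N W) s
                  ≡ labelSetting (λ z st → read N z >>= λ vs → forEach vs (body z) st) s
  dijkstra-loop N W = _ , λ s → refl

  dijkstra-body-within : ∀ X N W z v st → StateInv st →
                         Within (proj₁ (dijkstra-loop N W) z v st) StateInv
                                (potentialˢ X) (19 + potentialˢ X st)
  dijkstra-body-within X N W z v st inv with lookup (lookup W z) v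
  ... | nothing      = within inv (+-monoˡ-≤ (potentialˢ X st) {2} {19} (s≤s (s≤s z≤n)))
  ... | just (x , e) = spend 2 (relax-within X z v x e st inv)

  time-dijkstra : ∀ G s → time (dijkstra G s) ≤ 1 + 24 * ∣V∣ + 16 * nlogn + graphPotential G
  time-dijkstra G@(graph N W) s = begin
    time (dijkstra G s)
      ≤⟨ time-labelSetting (dijkstraWeight G) scans s ⟩
    1 + 22 * ∣V∣ + 16 * nlogn + ∑ Vs (dijkstraWeight G)
      ≡⟨ cong (1 + 22 * ∣V∣ + 16 * nlogn +_) (trans (∑-+ (λ _ → 2) _ Vs) (cong₂ _+_ (∑-allFin-const ∣V∣ 2)
           (trans (∑-cong (λ z → *-comm (length (lookup N z)) 20) Vs) (∑-* 20 _ Vs)))) ⟩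
    1 + 22 * ∣V∣ + 16 * nlogn + (∣V∣ * 2 + graphPotential G)
      ≡⟨ eq ∣V∣ nlogn (graphPotential G) ⟩
    1 + 24 * ∣V∣ + 16 * nlogn + graphPotential G ∎
    where
    open ≤-Reasoning
    Vs = allFin ∣V∣
    eq : ∀ n l g → 1 + 22 * n + 16 * l + (n * 2 + g) ≡ 1 + 24 * n + 16 * l + g
    eq = solve-∀
    scans : Scans (dijkstraWeight G)
            (λ z st → read N z >>= λ vs → forEach vs (proj₁ (dijkstra-loop N W) z) st)
    scans z st inv = weaken
      (spend 1 (forEach-within (λ _ → StateInv) (potentialˢ (dijkstraWeight G)) (λ _ → 19)
        (λ {v} {_} {st} inv → dijkstra-body-within (dijkstraWeight G) N W z v st inv)
        (lookup N z) st inv))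
      (≤-reflexive (cong (λ x → 2 + x + potentialˢ (dijkstraWeight G) st) (∑-const 20 (lookup N z))))

  -- The potential that the construction leaves in the graph is the variable part of the cost of
  -- Dijkstra's algorithm, so the two cancel.
  time-via-graph : ∀ {build : Timed Graph} {c} → Within build (λ _ → ⊤) graphPotential c →
                   ∀ s → time (build >>= λ G → dijkstra G s) ≤ 1 + 24 * ∣V∣ + 16 * nlogn + c
  time-via-graph {build} {c} (within _ b) s = by-sum 0 (+-mono-≤ b (time-dijkstra (result build) s))
    (eq (time build) (time (dijkstra (result build) s)) (graphPotential (result build)) c
        (1 + 24 * ∣V∣ + 16 * nlogn))
    where
    eq : ∀ t t′ g c a → t + t′ + (c + (a + g)) + 0 ≡ a + c + (t + g + t′)
    eq = solve-∀

  time-DR-SP : ∀ s → time (DR-SP s) ≤ 1 + 24 * ∣V∣ + 16 * nlogn + (1 + 55 * Φ)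
  time-DR-SP s = time-via-graph underlyingGraph-within s

  -- The simplicial construction.

  incidences : ℕ
  incidences = ∑ (allFin ∣E∣) (λ e → ∣ edge e ∣)

  visitCost : Edge → ℕ
  visitCost e = 1 + ∑ (cofacesOf e) (λ f → 1 + 4)

  levelCost : ℕ → ℕ
  levelCost i = 1 + ∑ (facesOfDim i) (λ e → 1 + visitCost e)

  faceWeights-within : Within faceWeights (λ _ → ⊤) (λ _ → 0)
                              (∣E∣ + (1 + ∑ (downFrom (suc maxFacetDim)) (λ i → 1 + levelCost i)))
  faceWeights-within = weaken
    (spend ∣E∣ (forEach-within (λ _ _ → ⊤) (λ _ → 0) levelCost
      (λ {i} {_} {T} _ → forEach-within (λ _ _ → ⊤) (λ _ → 0) visitCost
        (λ {e} {_} {T} _ → forEach-within (λ _ _ → ⊤) (λ _ → 0) (λ _ → 4)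
          (λ _ → within tt ≤-refl) (cofacesOf e) T tt)
        (facesOfDim i) T tt)
      (downFrom (suc maxFacetDim)) _ tt))
    (≤-reflexive (cong (∣E∣ +_) (+-identityʳ _)))

  -- A hyperedge has a single dimension, so the levels count it at most once.
  ∑-facesOfDim : ∀ f k → ∑ (downFrom k) (λ i → ∑ (facesOfDim i) f) ≤ ∑ (allFin ∣E∣) f
  ∑-facesOfDim f k = begin
    ∑ (downFrom k) (λ i → ∑ (facesOfDim i) f)
      ≡⟨ ∑-cong (λ i → ∑-filter (λ e → dim e ≟ℕ i) f Es) (downFrom k) ⟩
    ∑ (downFrom k) (λ i → ∑ Es (λ e → if does (dim e ≟ℕ i) then f e else 0))
      ≡⟨ ∑-swap _ (downFrom k) Es ⟩
    ∑ Es (λ e → ∑ (downFrom k) (λ i → if does (dim e ≟ℕ i) then f e else 0))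
      ≤⟨ ∑-mono (λ e → ∑-downFrom-single (dim e) (f e) k) Es ⟩
    ∑ Es f ∎
    where
    open ≤-Reasoning
    Es = allFin ∣E∣

  -- Each level costs 2; each face 1 for the initial copy and 2 for its loops; each pair of a face
  -- and a coface 5. The hypothesis is supplied by `∑-cofaces≤`.
  time-faceWeights : ∑ (allFin ∣E∣) (λ e → length (cofacesOf e)) ≤ incidences →
                     time faceWeights ≤ 1 + 2 * suc maxFacetDim + 3 * ∣E∣ + 5 * incidences
  time-faceWeights cofaces≤ = begin
    time faceWeights
      ≡⟨ +-identityʳ _ ⟨
    time faceWeights + 0
      ≤⟨ bound faceWeights-within ⟩
    ∣E∣ + (1 + ∑ is (λ i → 2 + ∑ (facesOfDim i) f))
      ≡⟨ cong (λ x → ∣E∣ + (1 + x)) (trans (∑-+ (λ _ → 2) _ is)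
           (cong (_+ ∑ is (λ i → ∑ (facesOfDim i) f))
                 (trans (∑-const 2 is) (cong (_* 2) (length-downFrom (suc maxFacetDim)))))) ⟩
    ∣E∣ + (1 + (suc maxFacetDim * 2 + ∑ is (λ i → ∑ (facesOfDim i) f)))
      ≤⟨ +-monoʳ-≤ ∣E∣ (s≤s (+-monoʳ-≤ (suc maxFacetDim * 2) (∑-facesOfDim f (suc maxFacetDim)))) ⟩
    ∣E∣ + (1 + (suc maxFacetDim * 2 + ∑ Es f))
      ≡⟨ cong (λ x → ∣E∣ + (1 + (suc maxFacetDim * 2 + x))) ∑f ⟩
    ∣E∣ + (1 + (suc maxFacetDim * 2 + (∣E∣ * 2 + 5 * ∑ Es (λ e → length (cofacesOf e)))))
      ≤⟨ by-sum 0 (*-monoʳ-≤ 5 cofaces≤)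
                  (eq ∣E∣ maxFacetDim (∑ Es (λ e → length (cofacesOf e))) incidences) ⟩
    1 + 2 * suc maxFacetDim + 3 * ∣E∣ + 5 * incidences ∎
    where
    open ≤-Reasoning
    is = downFrom (suc maxFacetDim)
    Es = allFin ∣E∣
    f : Edge → ℕ
    f e = 1 + visitCost e
    ∑f : ∑ Es f ≡ ∣E∣ * 2 + 5 * ∑ Es (λ e → length (cofacesOf e))
    ∑f = trans (∑-+ (λ _ → 2) _ Es) (cong₂ _+_ (∑-allFin-const ∣E∣ 2)
      (trans (∑-cong (λ e → trans (∑-const 5 (cofacesOf e)) (*-comm (length (cofacesOf e)) 5)) Es)
             (∑-* 5 _ Es)))
    eq : ∀ e d c i → e + (1 + (suc d * 2 + (e * 2 + 5 * c))) + 5 * i + 0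
                   ≡ 1 + 2 * suc d + 3 * e + 5 * i + 5 * c
    eq = solve-∀

  underlyingGraphSimplicial-within :
    ∑ (allFin ∣E∣) (λ e → length (cofacesOf e)) ≤ incidences →
    Within underlyingGraphSimplicial (λ _ → ⊤) graphPotential
           (2 + 2 * suc maxFacetDim + 63 * ∣E∣ + 5 * incidences)
  underlyingGraphSimplicial-within cofaces≤ = weaken
    (bind-within {m = faceWeights} {P = λ _ → ⊤} {pot = λ _ → 0} {d = 1 + ∑ (facesOfDim 1) cost}
      (within tt (≤-trans (≤-reflexive (+-identityʳ _)) (time-faceWeights cofaces≤)))
      λ {T} _ → weaken
        (bind-within {d = 1 + ∑ (facesOfDim 1) cost} noEdges-within λ {G} _ →
          forEach-within (λ _ _ → ⊤) graphPotential (λ e → 1 + pairCost (length (verticesOf e)))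
            (λ {e} {_} {G} _ → spend 1 (lendToPairs-within (lookup T e) (verticesOf e) G))
            (facesOfDim 1) G tt)
        ≤-refl)
    (by-sum 0 ∑cost (eq (∑ (facesOfDim 1) cost) maxFacetDim ∣E∣ incidences))
    where
    cost : Edge → ℕ
    cost e = 1 + (1 + pairCost (length (verticesOf e)))
    eq : ∀ c d e i → 1 + c + (1 + 2 * suc d + 3 * e + 5 * i) + 60 * e + 0
                   ≡ 2 + 2 * suc d + 63 * e + 5 * i + c
    eq = solve-∀
    ∣edge∣≡2 : ∀ e → dim e ≡ 1 → ∣ edge e ∣ ≡ 2
    ∣edge∣≡2 e dim≡1 with ∣ edge e ∣
    ∣edge∣≡2 e refl | 2 = refl
    cost≤ : ∀ e → (if does (dim e ≟ℕ 1) then cost e else 0) ≤ 60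
    cost≤ e with dim e ≡ᵇ 1 | ≡ᵇ⇒≡ (dim e) 1
    ... | false | _     = z≤n
    -- With two vertices `pairCost` is 58, so `cost e` evaluates to exactly 60.
    ... | true  | dim≡1 rewrite length-verticesOf e | ∣edge∣≡2 e (dim≡1 tt) = ≤ᵇ⇒≤ _ 60 tt
    ∑cost : ∑ (facesOfDim 1) cost ≤ 60 * ∣E∣
    ∑cost = ≤-trans (≤-reflexive (∑-filter (λ e → dim e ≟ℕ 1) cost (allFin ∣E∣)))
      (≤-trans (∑-mono cost≤ (allFin ∣E∣))
        (≤-reflexive (trans (∑-allFin-const ∣E∣ 60) (*-comm ∣E∣ 60))))

  time-DR-SP-simplicial :
    ∑ (allFin ∣E∣) (λ e → length (cofacesOf e)) ≤ incidences →
    ∀ s → time (DR-SP-simplicial s)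
          ≤ 1 + 24 * ∣V∣ + 16 * nlogn + (2 + 2 * suc maxFacetDim + 63 * ∣E∣ + 5 * incidences)
  time-DR-SP-simplicial cofaces≤ = time-via-graph (underlyingGraphSimplicial-within cofaces≤)

-- Counting hyperedges

2+k≤2[1+k] : ∀ k → 2 + k ≤ 2 * suc k
2+k≤2[1+k] k = s≤s (≤-trans (≤-reflexive (sym (+-comm k 1))) (+-monoʳ-≤ k (s≤s z≤n)))

-- Pigeonhole on the positions at which the values occur in `ys`; injectivity of `f` makes them
-- distinct.
injective-into⇒≤ : ∀ {a} {A : Set a} {k} {f : Fin k → A} {ys} → Injective _≡_ _≡_ f →
                   (∀ i → f i ∈ˡ ys) → k ≤ length ys
injective-into⇒≤ {ys = ys} f-inj f∈ys = injective⇒≤ {f = λ i → Any.index (f∈ys i)} λ {i} {j} eq →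
  f-inj (trans (lookup-index (f∈ys i)) (trans (cong (List.lookup ys) eq) (sym (lookup-index (f∈ys j)))))

lookup-injective : ∀ {a} {A : Set a} {xs : List A} → Unique xs → Injective _≡_ _≡_ (List.lookup xs)
lookup-injective (x∉ ∷ u) {zero}  {zero}  eq = refl
lookup-injective (x∉ ∷ u) {zero}  {suc j} eq = contradiction eq (All.lookup x∉ (∈-lookup j))
lookup-injective (x∉ ∷ u) {suc i} {zero}  eq = contradiction (sym eq) (All.lookup x∉ (∈-lookup i))
lookup-injective (x∉ ∷ u) {suc i} {suc j} eq = cong suc (lookup-injective u eq)

length-concatMap≤ : ∀ {a b} {A : Set a} {B : Set b} (f : A → List B) k xs →
                    All (λ x → length (f x) ≤ k) xs → length (concatMap f xs) ≤ length xs * k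
length-concatMap≤ f k []       []         = z≤n
length-concatMap≤ f k (x ∷ xs) (fx≤ ∷ fxs≤) =
  ≤-trans (≤-reflexive (length-++ (f x))) (+-mono-≤ fx≤ (length-concatMap≤ f k xs fxs≤))

subsets : ∀ {n} → Subset n → List (Subset n)
subsets []            = [] ∷ []
subsets (inside  ∷ p) = map (inside ∷_) (subsets p) ++ map (outside ∷_) (subsets p)
subsets (outside ∷ p) = map (outside ∷_) (subsets p)

length-subsets : ∀ {n} (p : Subset n) → length (subsets p) ≡ 2 ^ ∣ p ∣
length-subsets []            = refl
length-subsets (outside ∷ p) = trans (length-map (outside ∷_) (subsets p)) (length-subsets p)
length-subsets (inside  ∷ p) = trans (length-++ (map (inside ∷_) (subsets p))) (cong₂ _+_
  (trans (length-map (inside ∷_) (subsets p)) (length-subsets p))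
  (trans (length-map (outside ∷_) (subsets p)) (trans (length-subsets p) (sym (+-identityʳ _)))))

∈-subsets : ∀ {n} {p q : Subset n} → p ⊆ q → p ∈ˡ subsets q
∈-subsets {p = []}          {[]}          p⊆q = here refl
∈-subsets {p = inside  ∷ p} {outside ∷ q} p⊆q = contradiction (p⊆q here) λ()
∈-subsets {p = outside ∷ p} {outside ∷ q} p⊆q = ∈-map⁺ (outside ∷_) (∈-subsets (drop-∷-⊆ p⊆q))
∈-subsets {p = inside  ∷ p} {inside  ∷ q} p⊆q =
  ∈-++⁺ˡ (∈-map⁺ (inside ∷_) (∈-subsets (drop-∷-⊆ p⊆q)))
∈-subsets {p = outside ∷ p} {inside  ∷ q} p⊆q =
  ∈-++⁺ʳ (map (inside ∷_) (subsets q)) (∈-map⁺ (outside ∷_) (∈-subsets (drop-∷-⊆ p⊆q)))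

⊆∧∣∣≥⇒≡ : ∀ {n} {p q : Subset n} → p ⊆ q → ∣ q ∣ ≤ ∣ p ∣ → p ≡ q
⊆∧∣∣≥⇒≡ {p = []}          {[]}          p⊆q q≤p = refl
⊆∧∣∣≥⇒≡ {p = inside  ∷ p} {outside ∷ q} p⊆q q≤p = contradiction (p⊆q here) λ()
⊆∧∣∣≥⇒≡ {p = inside  ∷ p} {inside  ∷ q} p⊆q q≤p = cong (inside ∷_) (⊆∧∣∣≥⇒≡ (drop-∷-⊆ p⊆q) (s≤s⁻¹ q≤p))
⊆∧∣∣≥⇒≡ {p = outside ∷ p} {outside ∷ q} p⊆q q≤p = cong (outside ∷_) (⊆∧∣∣≥⇒≡ (drop-∷-⊆ p⊆q) q≤p)
⊆∧∣∣≥⇒≡ {p = outside ∷ p} {inside  ∷ q} p⊆q q≤p =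
  contradiction (≤-trans q≤p (p⊆q⇒∣p∣≤∣q∣ (drop-∷-⊆ p⊆q))) (n≮n ∣ q ∣)

module TimeBounds {c ℓ₁ ℓ₂ : Level} {K : Scalars c ℓ₁ ℓ₂} (H : Hypergraph K) where

  open Hypergraph H
  open AlgorithmAnalysis H
  open Algorithms H using (gallo; DR-SP; DR-SP-simplicial)

  private
    d = maxFacetDim
    m = ∣facets∣

  -- Climbing to strictly larger hyperedges terminates, since strict inclusion of finite sets is
  -- well-founded upwards.
  ∃-facet : ∀ e → ∃[ f ] IsFacet f × edge e ⊆ edge f
  ∃-facet e = go e (⊃-wellFounded (edge e))
    where
    go : ∀ e → Acc _⊃_ (edge e) → ∃[ f ] IsFacet f × edge e ⊆ edge f
    go e (acc rec) with any? (λ f → edge e ⊂? edge f)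
    ... | no  e-facet     = e , e-facet , id
    ... | yes (f , e⊂f) with go f (rec e⊂f)
    ...   | g , g-facet , f⊆g = g , g-facet , f⊆g ∘ proj₁ e⊂f

  ∈-facets : ∀ {f} → IsFacet f → f ∈ˡ facets
  ∈-facets {f} f-facet = ∈-filter⁺ isFacet? (∈-allFin f) f-facet

  1+dim : ∀ e → suc (dim e) ≡ ∣ edge e ∣
  1+dim e with ∣ edge e ∣ | 0<∣edge∣ e
  ... | suc _ | _ = refl

  facet≤ : ∀ {f} → f ∈ˡ facets → ∣ edge f ∣ ≤ suc d
  facet≤ {f} f∈ = ≤-trans (≤-reflexive (sym (1+dim f)))
    (s≤s (All.lookup (xs≤max 0 (map dim facets)) (∈-map⁺ dim f∈)))

  ∣edge∣≤ : ∀ e → ∣ edge e ∣ ≤ suc d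
  ∣edge∣≤ e with ∃-facet e
  ... | f , f-facet , e⊆f = ≤-trans (p⊆q⇒∣p∣≤∣q∣ e⊆f) (facet≤ (∈-facets f-facet))

  ∣E∣≤m2^ : ∣E∣ ≤ m * 2 ^ suc d
  ∣E∣≤m2^ = ≤-trans
    (injective-into⇒≤ {f = edge} edge-injective λ e → ∈-concatMap⁺ (subsets ∘ edge) (faces e))
    (length-concatMap≤ (subsets ∘ edge) (2 ^ suc d) facets
      (All.tabulate λ {f} f∈ → ≤-trans (≤-reflexive (length-subsets (edge f))) (^-monoʳ-≤ 2 (facet≤ f∈))))
    where
    faces : ∀ e → Any.Any (λ f → edge e ∈ˡ subsets (edge f)) facets
    faces e with ∃-facet e
    ... | f , f-facet , e⊆f = Any.map (λ { refl → ∈-subsets e⊆f }) (∈-facets f-facet)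

  ∣E∣≤∣V∣ : d ≡ 0 → ∣E∣ ≤ ∣V∣
  ∣E∣≤∣V∣ d≡0 = ≤-trans
    (injective-into⇒≤ {f = edge} {ys = map ⁅_⁆ (allFin ∣V∣)} edge-injective singleton)
    (≤-reflexive (trans (length-map ⁅_⁆ (allFin ∣V∣)) (length-tabulate id)))
    where
    singleton : ∀ e → edge e ∈ˡ map ⁅_⁆ (allFin ∣V∣)
    singleton e with edge-nonempty e
    ... | x , x∈e = subst (_∈ˡ map ⁅_⁆ (allFin ∣V∣))
      (⊆∧∣∣≥⇒≡ (λ y∈ → subst (_∈ edge e) (sym (x∈⁅y⁆⇒x≡y x y∈)) x∈e)
        (≤-trans (∣edge∣≤ e) (≤-reflexive (trans (cong suc d≡0) (sym (∣⁅x⁆∣≡1 x))))))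
      (∈-map⁺ ⁅_⁆ (∈-allFin x))

  coface? = λ e f → (edge e ⊂? edge f) ×-dec (dim f ≟ℕ suc (dim e))

  -- If `f` covers `e`, the witness `x` of strictness gives `edge e ⊆ edge f - x`, and the
  -- dimensions force equality. So distinct faces are distinct entries of a list indexed by the
  -- vertices of `f`.
  faces≤ : ∀ f → length (filter (λ e → coface? e f) (allFin ∣E∣)) ≤ ∣ edge f ∣
  faces≤ f = ≤-trans
    (injective-into⇒≤ {f = edge ∘ List.lookup faces} {ys = map (edge f -_) (verticesOf f)}
      (λ eq → lookup-injective (Unique.filter⁺ (λ e → coface? e f) (Unique.allFin⁺ ∣E∣)) (edge-injective eq))
      (λ i → face∈ (List.lookup faces i)
                   (proj₂ (∈-filter⁻ (λ e → coface? e f) {xs = allFin ∣E∣} (∈-lookup i)))))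
    (≤-reflexive (trans (length-map (edge f -_) (verticesOf f)) (length-verticesOf f)))
    where
    faces = filter (λ e → coface? e f) (allFin ∣E∣)
    face∈ : ∀ e → edge e ⊂ edge f × dim f ≡ suc (dim e) → edge e ∈ˡ map (edge f -_) (verticesOf f)
    face∈ e ((e⊆f , x , x∈f , x∉e) , dims) = subst (_∈ˡ map (edge f -_) (verticesOf f))
      (sym (⊆∧∣∣≥⇒≡ e⊆f-x (s≤s⁻¹ (≤-trans (x∈p⇒∣p-x∣<∣p∣ x∈f) (≤-reflexive
        (trans (sym (1+dim f)) (cong suc (trans dims (1+dim e)))))))))
      (∈-map⁺ (edge f -_) (∈-filter⁺ (_∈? edge f) (∈-allFin x) x∈f))
      where
      e⊆f-x : edge e ⊆ edge f - x
      e⊆f-x {y} y∈e = x∈p∧x≢y⇒x∈p-y (e⊆f y∈e) λ { refl → x∉e y∈e }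

  ∑-cofaces≤ : ∑ (allFin ∣E∣) (λ e → length (cofacesOf e)) ≤ incidences
  ∑-cofaces≤ = begin
    ∑ Es (λ e → length (cofacesOf e))
      ≡⟨ ∑-cong (λ e → length-filter≡∑ (coface? e) Es) Es ⟩
    ∑ Es (λ e → ∑ Es (λ f → if does (coface? e f) then 1 else 0))
      ≡⟨ ∑-swap _ Es Es ⟩
    ∑ Es (λ f → ∑ Es (λ e → if does (coface? e f) then 1 else 0))
      ≡⟨ ∑-cong (λ f → length-filter≡∑ (λ e → coface? e f) Es) Es ⟨
    ∑ Es (λ f → length (filter (λ e → coface? e f) Es))
      ≤⟨ ∑-mono faces≤ Es ⟩
    incidences ∎
    where
    open ≤-Reasoning
    Es = allFin ∣E∣

  incidences≤ : incidences ≤ ∣E∣ * suc d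
  incidences≤ = ≤-trans (∑-mono ∣edge∣≤ (allFin ∣E∣)) (≤-reflexive (∑-allFin-const ∣E∣ (suc d)))

  Φ≤ : Φ ≤ ∣E∣ * suc d ^ 2
  Φ≤ = ≤-trans (∑-mono (λ e → ^-monoˡ-≤ 2 (∣edge∣≤ e)) (allFin ∣E∣))
               (≤-reflexive (∑-allFin-const ∣E∣ (suc d ^ 2)))

  -- For positive `d`, the 4 combines 2^(d+1) = 2 · 2^d with d + 1 ≤ 2d; the summand `∣V∣` takes
  -- care of `d = 0`. Passing `d` and both counts as arguments to `by-cases` makes the case
  -- distinction possible.
  ∣E∣[1+d]≤ : ∣E∣ * suc d ≤ ∣V∣ + 4 * (d * 2 ^ d * m)
  ∣E∣[1+d]≤ = by-cases d ∣E∣≤∣V∣ ∣E∣≤m2^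
    where
    by-cases : ∀ d → (d ≡ 0 → ∣E∣ ≤ ∣V∣) → ∣E∣ ≤ m * 2 ^ suc d →
               ∣E∣ * suc d ≤ ∣V∣ + 4 * (d * 2 ^ d * m)
    by-cases zero    E≤V _ = ≤-trans (≤-reflexive (*-identityʳ ∣E∣)) (≤-trans (E≤V refl) (m≤m+n ∣V∣ 0))
    by-cases (suc k) _ E≤ = begin
      ∣E∣ * (2 + k)                           ≤⟨ *-mono-≤ E≤ (2+k≤2[1+k] k) ⟩
      m * 2 ^ (2 + k) * (2 * suc k)           ≡⟨ eq m (2 ^ suc k) k ⟩
      4 * (suc k * 2 ^ suc k * m)             ≤⟨ m≤n+m _ ∣V∣ ⟩
      ∣V∣ + 4 * (suc k * 2 ^ suc k * m)       ∎
      where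
      open ≤-Reasoning
      eq : ∀ m p k → m * (2 * p) * (2 * suc k) ≡ 4 * (suc k * p * m)
      eq = solve-∀

  -- As before, but with d + 1 ≤ 2d squared: 8 = 2 · 2².
  ∣E∣[1+d]²≤ : ∣E∣ * suc d ^ 2 ≤ ∣V∣ + 8 * (d ^ 2 * 2 ^ d * m)
  ∣E∣[1+d]²≤ = by-cases d ∣E∣≤∣V∣ ∣E∣≤m2^
    where
    by-cases : ∀ d → (d ≡ 0 → ∣E∣ ≤ ∣V∣) → ∣E∣ ≤ m * 2 ^ suc d →
               ∣E∣ * suc d ^ 2 ≤ ∣V∣ + 8 * (d ^ 2 * 2 ^ d * m)
    by-cases zero    E≤V _ = ≤-trans (≤-reflexive (*-identityʳ ∣E∣)) (≤-trans (E≤V refl) (m≤m+n ∣V∣ 0))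
    by-cases (suc k) _ E≤ = begin
      ∣E∣ * (2 + k) ^ 2                       ≤⟨ *-mono-≤ E≤ (^-monoˡ-≤ 2 (2+k≤2[1+k] k)) ⟩
      m * 2 ^ (2 + k) * (2 * suc k) ^ 2       ≡⟨ eq m (2 ^ suc k) k ⟩
      8 * (suc k ^ 2 * 2 ^ suc k * m)         ≤⟨ m≤n+m _ ∣V∣ ⟩
      ∣V∣ + 8 * (suc k ^ 2 * 2 ^ suc k * m)   ∎
      where
      open ≤-Reasoning
      eq : ∀ m p k → m * (2 * p) * (2 * suc k * (2 * suc k * 1)) ≡ 8 * (suc k * (suc k * 1) * p * m)
      eq = solve-∀

  -- Absorbs the loop over the dimensions in `faceWeights`, whose cost is linear in `d`.
  d≤∣V∣ : d ≤ ∣V∣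
  d≤∣V∣ = max≤v⁺ {xs = map dim facets} z≤n (All.tabulate dims)
    where
    dims : ∀ {i} → i ∈ˡ map dim facets → i ≤ ∣V∣
    dims i∈ with ∈-map⁻ dim i∈
    ... | f , _ , refl = ≤-trans (m∸n≤m ∣ edge f ∣ 1) (∣p∣≤n (edge f))

  -- Absorbing the lower-order terms.

  module _ (2≤n : 2 ≤ ∣V∣) where

    -- From two vertices on the logarithm is at least 1; this absorbs every linear and constant term
    -- below.
    n≤nlogn : ∣V∣ ≤ nlogn
    n≤nlogn = ≤-trans (≤-reflexive (sym (*-identityʳ ∣V∣))) (*-monoʳ-≤ ∣V∣ (⌊log₂⌋-mono-≤ 2≤n))

    1≤nlogn : 1 ≤ nlogn
    1≤nlogn = ≤-trans (s≤s z≤n) (≤-trans 2≤n n≤nlogn)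

    gallo-O : ∀ s → time (gallo s) ≤ 40 * (nlogn + Φ)
    gallo-O s = by-sum (20 * Φ)
      (+-mono-≤ (time-gallo s) (+-mono-≤ 1≤nlogn (*-monoʳ-≤ 23 n≤nlogn)))
      (eq (time (gallo s)) ∣V∣ nlogn Φ)
      where
      eq : ∀ t n l p → t + (1 + 23 * n + 16 * l + 20 * p + (l + 23 * l)) + 20 * p
                     ≡ 40 * (l + p) + (t + (1 + 23 * n))
      eq = solve-∀

    DR-SP-O : ∀ s → time (DR-SP s) ≤ 55 * (nlogn + Φ)
    DR-SP-O s = by-sum (13 * nlogn)
      (+-mono-≤ (time-DR-SP s) (+-mono-≤ (*-monoʳ-≤ 2 1≤nlogn) (*-monoʳ-≤ 24 n≤nlogn)))
      (eq (time (DR-SP s)) ∣V∣ nlogn Φ)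
      where
      eq : ∀ t n l p → t + (1 + 24 * n + 16 * l + (1 + 55 * p) + (2 * l + 24 * l)) + 13 * l
                     ≡ 55 * (l + p) + (t + (2 * 1 + 24 * n))
      eq = solve-∀

    gallo-simplicial-O : ∀ s → time (gallo s) ≤ 160 * (nlogn + d ^ 2 * 2 ^ d * m)
    gallo-simplicial-O s = by-sum (100 * nlogn)
      (+-mono-≤ (time-gallo s) (+-mono-≤ (*-monoʳ-≤ 20 (≤-trans Φ≤ ∣E∣[1+d]²≤))
        (+-mono-≤ 1≤nlogn (*-monoʳ-≤ 43 n≤nlogn))))
      (eq (time (gallo s)) ∣V∣ nlogn Φ (d ^ 2 * 2 ^ d * m))
      where
      eq : ∀ t n l p x → t + (1 + 23 * n + 16 * l + 20 * p + (20 * (n + 8 * x) + (l + 43 * l))) + 100 * l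
                       ≡ 160 * (l + x) + (t + (20 * p + (1 + 43 * n)))
      eq = solve-∀

    DR-SP-simplicial-O : ∀ s → time (DR-SP-simplicial s) ≤ 272 * (nlogn + d * 2 ^ d * m)
    -- Both `∣E∣` and `incidences` are at most `∣E∣ * suc d`, with coefficients 63 and 5. Hence 68,
    -- and 272 = 68 · 4. The 94 gathers the linear terms 24, 68 and 2.
    DR-SP-simplicial-O s = by-sum (157 * nlogn)
      (+-mono-≤ (time-DR-SP-simplicial ∑-cofaces≤ s)
        (+-mono-≤ (*-monoʳ-≤ 63 (m≤m*n ∣E∣ (suc d)))
        (+-mono-≤ (*-monoʳ-≤ 5 incidences≤)
        (+-mono-≤ (*-monoʳ-≤ 68 ∣E∣[1+d]≤)
        (+-mono-≤ (*-monoʳ-≤ 2 d≤∣V∣)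
        (+-mono-≤ (*-monoʳ-≤ 5 1≤nlogn) (*-monoʳ-≤ 94 n≤nlogn)))))))
      (eq (time (DR-SP-simplicial s)) ∣V∣ nlogn (d * 2 ^ d * m) ∣E∣ incidences (∣E∣ * suc d) d)
      where
      eq : ∀ t n l x e i f d →
           t + (1 + 24 * n + 16 * l + (2 + 2 * suc d + 63 * e + 5 * i)
                + (63 * f + (5 * f + (68 * (n + 4 * x) + (2 * n + (5 * l + 94 * l)))))) + 157 * l
           ≡ 272 * (l + x) + (t + (63 * e + (5 * i + (68 * f + (2 * d + (5 * 1 + 94 * n))))))
      eq = solve-∀

theorem4 : ∀ {c ℓ₁ ℓ₂} →
  let open Instance
      n      = λ (I : Instance c ℓ₁ ℓ₂) → ∣V∣ I
      nlogn  = λ (I : Instance c ℓ₁ ℓ₂) → n I * ⌊log₂ (n I) ⌋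
      m      = λ (I : Instance c ℓ₁ ℓ₂) → ∣facets∣ I
      d      = λ (I : Instance c ℓ₁ ℓ₂) → maxFacetDim I
  in
    ( BigO {A = Instance c ℓ₁ ℓ₂} n
        (λ I → time (gallo I (source I)))
        (λ I → nlogn I + Φ I)
    × BigO {A = Instance c ℓ₁ ℓ₂} n
        (λ I → time (DR-SP I (source I)))
        (λ I → nlogn I + Φ I) )
  × ( BigO {A = SimplicialInstance c ℓ₁ ℓ₂} (λ (I , _) → n I)
        (λ (I , _) → time (gallo I (source I)))
        (λ (I , _) → nlogn I + d I ^ 2 * 2 ^ d I * m I)
    × BigO {A = SimplicialInstance c ℓ₁ ℓ₂} (λ (I , _) → n I)
        (λ (I , _) → time (DR-SP-simplicial I (source I)))
        (λ (I , _) → nlogn I + d I * 2 ^ d I * m I) )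
theorem4 =
    ( (40  , λ I 2≤n → gallo-O (hypergraph I) 2≤n (source I))
    , (55  , λ I 2≤n → DR-SP-O (hypergraph I) 2≤n (source I)) )
  , ( (160 , λ (I , _) 2≤n → gallo-simplicial-O (hypergraph I) 2≤n (source I))
    , (272 , λ (I , _) 2≤n → DR-SP-simplicial-O (hypergraph I) 2≤n (source I)) )
  where
  open Instance using (hypergraph; source)
  open TimeBounds
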